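{- Let $\eta\in(0,1)$ be fixed, and let $k$ and $r$ be non-negative integers with $k\ge 2$. Let $P$ be sufficiently large in terms of $\eta$, $k$ and $r$. Suppose that $\mathbf h\in\mathbb Z^k$ is a coefficient $k$-tuple having the property that $$U_{k+1,k}(P;\mathbf h)>P^{r+\eta}.\qquad (*)$$ Then one has $0\le r\le (k-1)/2$, and for some integers $a_i$ with $|a_i|\le P$ $(1\le i\le k-1-2r)$, one has $$h_j=a_1^{2j-1}+\ldots+a_{k-1-2r}^{2j-1}\quad (1\le j\le k).$$ In particular, when $r$ is the largest integer for which the lower bound $(*)$ holds for some $\eta\in(0,1)$, then for every $\varepsilon>0$, we have $$P^{r+1}\ll U_{k+1,k}(P;\mathbf h)\ll P^{r+1+\varepsilon}.$$
   Context: $P$ denotes a large positive integer. For natural numbers $s$ and $k$, and $\mathbf h=(h_1,\ldots,h_k)\in\mathbb Z^k$, $U_{s,k}(P;\mathbf h)$ denotes the number of integral solutions $(x_1,\ldots,x_s)$ of the system $$\sum_{i=1}^s x_i^{2j-1}=h_j\quad (1\le j\le k),$$ with $|x_i|\le P$ $(1\le i\le s)$. -}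

module Defs where

open import Data.Fin.Base using (Fin; toℕ)
open import Data.Fin.Properties using (all?)
open import Data.Integer.Base as ℤ using (ℤ; +_; 0ℤ; ∣_∣)
import Data.Integer.Properties as ℤ
open import Data.List.Base as List using (List; []; _∷_; length; filter; upTo; cartesianProductWith)
open import Data.Nat.Base using (ℕ; zero; suc; _+_; _*_; _^_; _≤_; _<_)
open import Data.Product.Base using (Σ-syntax; ∃; _×_)
open import Data.Rational.Base as ℚ using (ℚ; 0ℚ; 1ℚ; ↥_; ↧ₙ_)
open import Data.Sum.Base using (_⊎_)
open import Data.Vec.Base as Vec using (Vec; []; _∷_; lookup)
open import Function.Bundles using (_⇔_)
open import Level using (0ℓ)
open import Relation.Binary.PropositionalEquality using (_≡_)
open import Relation.Nullary.Decidable using (Dec)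
open import Relation.Nullary.Negation using (¬_)
open import Relation.Unary using (Pred)

-- Real numbers as two-sided Dedekind cuts: lower q means q < x, and
-- upper q means x < q.
record ℝ : Set₁ where
  field
    lower           : Pred ℚ 0ℓ
    upper           : Pred ℚ 0ℓ
    lower-inhabited : ∃ lower
    upper-inhabited : ∃ upper
    lower-rounded   : ∀ {p} → lower p ⇔ (Σ[ q ∈ ℚ ] p ℚ.< q × lower q)
    upper-rounded   : ∀ {q} → upper q ⇔ (Σ[ p ∈ ℚ ] p ℚ.< q × upper p)
    disjoint        : ∀ {q} → ¬ (lower q × upper q)
    located         : ∀ {p q} → p ℚ.< q → lower p ⊎ upper q

open ℝ public

infix 4 _^[_⊕_]<_ _≤_·_^[_⊕_]

Positive : ℝ → Set
Positive x = lower x 0ℚ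

InUnitInterval : ℝ → Set
InUnitInterval x = Positive x × upper x 1ℚ

-- P ^[ m ⊕ x ]< N  says  P^(m + x) < N, for a real x ≥ 0 and P ≥ 1.
-- By continuity of t ↦ P^t this means P^(m + q) < N for some rational
-- q > x.  Such a q = a / b is positive, so |↥ q| = a, and raising to the
-- b-th power gives P^(m b + a) < N^b.
_^[_⊕_]<_ : ℕ → ℕ → ℝ → ℕ → Set
P ^[ m ⊕ x ]< N =
  Σ[ q ∈ ℚ ] upper x q × P ^ (m * ↧ₙ q + ∣ ↥ q ∣) < N ^ ↧ₙ q

-- N ≤ C · P ^[ m ⊕ x ]  says  N ≤ C · P^(m + x), for a real x ≥ 0 and
-- P ≥ 1; equivalently N ≤ C · P^(m + q) for every rational q > x.
_≤_·_^[_⊕_] : ℕ → ℕ → ℕ → ℕ → ℝ → Set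
N ≤ C · P ^[ m ⊕ x ] =
  ∀ q → upper x q → N ^ ↧ₙ q ≤ C ^ ↧ₙ q * P ^ (m * ↧ₙ q + ∣ ↥ q ∣)

powerSum : ℕ → ∀ {s} → Vec ℤ s → ℤ
powerSum n xs = Vec.foldr′ ℤ._+_ 0ℤ (Vec.map (ℤ._^ n) xs)

-- Fin k counts from 0, so the index j here stands for j + 1, and the
-- exponent 2 (j + 1) - 1 is 2 j + 1.
OddPowerSystem : ∀ {s k} → Vec ℤ k → Vec ℤ s → Set
OddPowerSystem {k = k} h xs =
  ∀ (j : Fin k) → powerSum (suc (2 * toℕ j)) xs ≡ lookup h j

oddPowerSystem? : ∀ {s k} (h : Vec ℤ k) (xs : Vec ℤ s) → Dec (OddPowerSystem h xs)
oddPowerSystem? h xs = all? λ j → powerSum (suc (2 * toℕ j)) xs ℤ.≟ lookup h j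

-- The integers -P, …, P, each listed once.
interval : ℕ → List ℤ
interval P = List.map (λ i → + i ℤ.- + P) (upTo (suc (2 * P)))

tuples : ∀ {A : Set} → List A → (s : ℕ) → List (Vec A s)
tuples xs zero    = [] ∷ []
tuples xs (suc s) = cartesianProductWith _∷_ xs (tuples xs s)

U : (s k P : ℕ) → Vec ℤ k → ℕ
U s k P h = length (filter (oddPowerSystem? h) (tuples (interval P) s))

-- A notion of "sufficiently large in terms of η and r", for a fixed k.
Threshold : Set₁
Threshold = (η : ℝ) → InUnitInterval η → ℕ → ℕ

LowerBound : (k P : ℕ) → Vec ℤ k → ℕ → ℝ → Set
LowerBound k P h r η = P ^[ r ⊕ η ]< U (suc k) k P h

-- The lower bound holds for some η ∈ (0,1), where P is still required to
-- be sufficiently large in terms of that η.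
LowerBoundForSome : Threshold → (k P : ℕ) → Vec ℤ k → ℕ → Set₁
LowerBoundForSome P₀ k P h r =
  Σ[ η ∈ ℝ ] Σ[ η∈I ∈ InUnitInterval η ] P₀ η η∈I r ≤ P × LowerBound k P h r η

IsLargest : ∀ {a} → Pred ℕ a → Pred ℕ a
IsLargest A r = A r × (∀ r′ → A r′ → r′ ≤ r)

{-# OPTIONS --safe #-}

-- Let F(t) be the product of the t - xᵢ and t + yⱼ for two solutions x and y
-- of the system.  By Newton's identities its coefficients at odd powers of t
-- vanish, except possibly e at t itself.  Call a solution a core if no
-- xᵢ + xⱼ is zero, i = j included.
--
-- Two cores with at most k entries have no room for e: F is even, and so
-- they consist of the same integers.  Hence the solutions that reduce to a
-- shorter core by removing zeros and at most r pairs v, - v number O(P^r).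
--
-- For cores x, y with k + 1 entries, if e = 0 the previous argument applies.
-- Otherwise F(xₐ) = 0 evaluates F(- xₐ) in terms of e, and the product over
-- a, compared with the same product for y, shows that the product of the
-- sums xᵢ + xⱼ (i < j) is up to sign the same for y.  Each xᵢ + xⱼ thus
-- divides a fixed nonzero number, and the divisor bound leaves O(P^δ) such
-- solutions.
--
-- So if there are more than P^(r+η) solutions, one of them contains r + 1
-- pairs; what remains represents h.
module Submission where

open import Defs
open import Algebra.Bundles using (module AbelianGroup)
open import Data.Fin.Base as Fin using (Fin; zero; suc; toℕ; fromℕ<; punchOut)
import Data.Fin.Properties as Fin
open import Data.Integer.Base as ℤ using (ℤ; +_; -[1+_]; 0ℤ; 1ℤ; ∣_∣)
import Data.Integer.Properties as ℤ
open import Algebra.Properties.Group (AbelianGroup.group ℤ.+-0-abelianGroup) using (∙-cancelʳ)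
import Data.Integer.Tactic.RingSolver as ℤ
open import Data.List.Base as List
  using (List; []; _∷_; length; filter; upTo; cartesianProductWith; concatMap; tabulate)
import Data.List.Properties as List
open import Data.List.Membership.Propositional using (_∈_; lose)
open import Data.List.Membership.Propositional.Properties
  using (∈-cartesianProductWith⁺; ∈-cartesianProductWith⁻; ∈-upTo⁺; ∈-upTo⁻; ∈-map⁺; ∈-map⁻; ∈-∃++; ∈-++⁺ˡ; ∈-++⁺ʳ;
         ∈-++⁻; ∈-filter⁺; ∈-filter⁻; ∈-tabulate⁺; ∈-concatMap⁺)
open import Data.List.Relation.Unary.All as AllL using ([]; _∷_)
open import Data.List.Relation.Unary.Any using (here; there)
open import Data.List.Relation.Unary.Unique.Propositional using (Unique; []; _∷_)
import Data.List.Relation.Unary.Unique.Propositional.Properties as Unique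
open import Data.Nat.Base
  using (ℕ; zero; suc; _+_; _*_; _∸_; _^_; _≤_; _<_; z≤n; s≤s; z<s; s<s; ⌊_/2⌋; NonZero; ≢-nonZero; >-nonZero;
         n>1⇒nonTrivial)
open import Data.Nat.Divisibility
  using (_∣_; _∣?_; divides; hasNonTrivialDivisor; 1∣_; ∣1⇒≡1; *-cancelʳ-∣; ∣m⇒∣m*n; ∣n⇒∣m*n; m∣m*n; n∣m*n)
open import Data.Nat.DivMod using (_/_; _%_; m≡m%n+[m/n]*n; m%n<n; m/n*n≤m)
open import Data.Nat.Induction using (<-rec)
open import Data.Nat.ListAction using (product)
open import Data.Nat.ListAction.Properties using (∈⇒∣product)
open import Data.Nat.Primality
  using (Prime; _Rough_; euclidsLemma; prime⇒nonZero; prime⇒nonTrivial; 2-rough; ∤⇒rough-suc; rough∧∣⇒rough;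
         rough∧∣⇒prime)
open import Data.Nat.Primality.Factorisation using (PrimeFactorisation; factorise)
import Data.Nat.Properties as ℕ
import Data.Nat.Tactic.RingSolver as ℕ
open import Data.Product.Base using (Σ-syntax; ∃; _×_; _,_; proj₁; proj₂)
open import Data.Rational.Base as ℚ using (ℚ; mkℚ; 0ℚ; 1ℚ; ½; ↥_; ↧ₙ_)
import Data.Rational.Properties as ℚ
open import Data.Sum.Base using (_⊎_; inj₁; inj₂; [_,_]′)
open import Data.Vec.Base as Vec using (Vec; []; _∷_; lookup; replicate; _++_; removeAt)
import Data.Vec.Properties as Vec
open import Data.Vec.Relation.Unary.All using (All; []; _∷_)
open import Function.Base using (_∘_)
open import Function.Bundles using (mk⇔; module Equivalence)
open import Relation.Binary.Definitions using (tri<; tri≈; tri>)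
open import Relation.Binary.PropositionalEquality
open import Relation.Nullary.Decidable using (Dec; yes; no; ¬?; decidable-stable; from-yes)
open import Relation.Nullary.Negation using (¬_; contradiction)

private variable
  A : Set
  m n k P : ℕ


-- Finite products

Π : (ℤ → ℤ) → Vec ℤ n → ℤ
Π f []       = 1ℤ
Π f (x ∷ xs) = f x ℤ.* Π f xs

-- Newton's identities

-- The coefficient of t^j in the product of the 1 - z t.
coefficient : Vec ℤ n → ℕ → ℤ
coefficient zs       zero    = 1ℤ
coefficient []       (suc j) = 0ℤ
coefficient (z ∷ zs) (suc j) = coefficient zs (suc j) ℤ.- z ℤ.* coefficient zs j

convolution : (ℕ → ℤ) → (ℕ → ℤ) → ℕ → ℤ
convolution f g zero    = f 0 ℤ.* g 0
convolution f g (suc n) = f 0 ℤ.* g (suc n) ℤ.+ convolution (f ∘ suc) g n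

convolution-cong : ∀ {f f′ g g′} → (∀ i → f i ≡ f′ i) → (∀ i → g i ≡ g′ i) →
                   ∀ n → convolution f g n ≡ convolution f′ g′ n
convolution-cong p q zero    = cong₂ ℤ._*_ (p 0) (q 0)
convolution-cong p q (suc n) =
  cong₂ ℤ._+_ (cong₂ ℤ._*_ (p 0) (q (suc n))) (convolution-cong (p ∘ suc) q n)

convolution-+ˡ : ∀ f f′ g n →
  convolution (λ i → f i ℤ.+ f′ i) g n ≡ convolution f g n ℤ.+ convolution f′ g n
convolution-+ˡ f f′ g zero    = ℤ.*-distribʳ-+ (g 0) (f 0) (f′ 0)
convolution-+ˡ f f′ g (suc n) =
  trans (cong (λ w → (f 0 ℤ.+ f′ 0) ℤ.* g (suc n) ℤ.+ w) (convolution-+ˡ (f ∘ suc) (f′ ∘ suc) g n))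
        (lemma (f 0) (f′ 0) (g (suc n)) _ _)
  where
  lemma : ∀ a b c u v → (a ℤ.+ b) ℤ.* c ℤ.+ (u ℤ.+ v) ≡ (a ℤ.* c ℤ.+ u) ℤ.+ (b ℤ.* c ℤ.+ v)
  lemma = ℤ.solve-∀

-- Prepending the root `z` multiplies the generating function of the coefficients by `1 - z t`.
convolution-step : ∀ f z zs n →
  convolution f (coefficient {suc m} (z ∷ zs)) (suc n) ≡
  convolution f (coefficient zs) (suc n) ℤ.- z ℤ.* convolution f (coefficient zs) n
convolution-step f z zs zero = lemma (f 0) (f 1) z (coefficient zs 1)
  where
  lemma : ∀ a b z c → a ℤ.* (c ℤ.- z ℤ.* 1ℤ) ℤ.+ b ℤ.* 1ℤ ≡
                      (a ℤ.* c ℤ.+ b ℤ.* 1ℤ) ℤ.- z ℤ.* (a ℤ.* 1ℤ)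
  lemma = ℤ.solve-∀
convolution-step f z zs (suc n) =
  trans (cong (λ w → f 0 ℤ.* coefficient (z ∷ zs) (2 + n) ℤ.+ w)
              (convolution-step (f ∘ suc) z zs n))
        (lemma (f 0) z (coefficient zs (2 + n)) (coefficient zs (suc n)) _ _)
  where
  lemma : ∀ a z c d u v → a ℤ.* (c ℤ.- z ℤ.* d) ℤ.+ (u ℤ.- z ℤ.* v) ≡
                          (a ℤ.* c ℤ.+ u) ℤ.- z ℤ.* (a ℤ.* d ℤ.+ v)
  lemma = ℤ.solve-∀

-- The series of the `c z^i` is `c / (1 - z t)`, so it cancels the factor that `z` contributes to
-- the product.
convolution-geometric : ∀ c z zs n →
  convolution (λ i → c ℤ.* z ℤ.^ i) (coefficient {suc m} (z ∷ zs)) n ≡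
  c ℤ.* coefficient zs n
convolution-geometric c z zs zero = lemma c
  where
  lemma : ∀ c → (c ℤ.* 1ℤ) ℤ.* 1ℤ ≡ c ℤ.* 1ℤ
  lemma = ℤ.solve-∀
convolution-geometric c z zs (suc n) = begin
  c ℤ.* 1ℤ ℤ.* coefficient (z ∷ zs) (suc n) ℤ.+
    convolution (λ i → c ℤ.* (z ℤ.* z ℤ.^ i)) (coefficient (z ∷ zs)) n
    ≡⟨ cong (λ w → c ℤ.* 1ℤ ℤ.* coefficient (z ∷ zs) (suc n) ℤ.+ w)
         (trans (convolution-cong (λ i → sym (ℤ.*-assoc c z (z ℤ.^ i))) (λ _ → refl) n)
                (convolution-geometric (c ℤ.* z) z zs n)) ⟩
  c ℤ.* 1ℤ ℤ.* coefficient (z ∷ zs) (suc n) ℤ.+ c ℤ.* z ℤ.* coefficient zs n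
    ≡⟨ lemma c z (coefficient zs (suc n)) (coefficient zs n) ⟩
  c ℤ.* coefficient zs (suc n) ∎
  where
  open ≡-Reasoning
  lemma : ∀ c z a b → c ℤ.* 1ℤ ℤ.* (a ℤ.- z ℤ.* b) ℤ.+ c ℤ.* z ℤ.* b ≡ c ℤ.* a
  lemma = ℤ.solve-∀

-- With `E(t)` the product of the `1 - z t` and `p(t)` the generating function of the power sums,
-- this is the logarithmic derivative `p(t) E(t) = - E'(t)`, compared at `t^j`. In the induction the
-- new root contributes a geometric series, and `convolution-step` treats the other power sums.
newton : ∀ (zs : Vec ℤ n) j →
  convolution (λ i → powerSum (suc i) zs) (coefficient zs) j ≡
  ℤ.- (+ suc j ℤ.* coefficient zs (suc j))
newton []       zero    = refl
newton []       (suc j) =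
  trans (trans (ℤ.+-identityˡ _) (newton [] j))
        (trans (cong ℤ.-_ (ℤ.*-zeroʳ (+ suc j)))
               (sym (cong ℤ.-_ (ℤ.*-zeroʳ (+ suc (suc j))))))
newton (z ∷ zs) j = begin
  convolution (λ i → z ℤ.^ suc i ℤ.+ p i) (coefficient (z ∷ zs)) j
    ≡⟨ convolution-+ˡ (λ i → z ℤ.^ suc i) p _ j ⟩
  convolution (λ i → z ℤ.* z ℤ.^ i) (coefficient (z ∷ zs)) j ℤ.+
    convolution p (coefficient (z ∷ zs)) j
    ≡⟨ cong₂ ℤ._+_ (convolution-geometric z z zs j) (rest j) ⟩
  z ℤ.* e j ℤ.+ (ℤ.- (+ suc j ℤ.* e (suc j)) ℤ.+ z ℤ.* (+ j ℤ.* e j))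
    ≡⟨ lemma z (e j) (e (suc j)) (+ j) ⟩
  ℤ.- (+ suc j ℤ.* (e (suc j) ℤ.- z ℤ.* e j)) ∎
  where
  open ≡-Reasoning
  p = λ i → powerSum (suc i) zs
  e = coefficient zs
  rest : ∀ j → convolution p (coefficient (z ∷ zs)) j ≡
               ℤ.- (+ suc j ℤ.* e (suc j)) ℤ.+ z ℤ.* (+ j ℤ.* e j)
  rest zero    = trans (newton zs 0) (lemma₀ (e 1) z)
    where
    lemma₀ : ∀ a z → ℤ.- (1ℤ ℤ.* a) ≡ ℤ.- (1ℤ ℤ.* a) ℤ.+ z ℤ.* 0ℤ
    lemma₀ = ℤ.solve-∀
  rest (suc j) = begin
    convolution p (coefficient (z ∷ zs)) (suc j)
      ≡⟨ convolution-step p z zs j ⟩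
    convolution p e (suc j) ℤ.- z ℤ.* convolution p e j
      ≡⟨ cong₂ (λ u v → u ℤ.- z ℤ.* v) (newton zs (suc j)) (newton zs j) ⟩
    ℤ.- (+ suc (suc j) ℤ.* e (2 + j)) ℤ.- z ℤ.* ℤ.- (+ suc j ℤ.* e (suc j))
      ≡⟨ lemma₁ (+ suc (suc j) ℤ.* e (2 + j)) z (+ suc j ℤ.* e (suc j)) ⟩
    ℤ.- (+ suc (suc j) ℤ.* e (2 + j)) ℤ.+ z ℤ.* (+ suc j ℤ.* e (suc j)) ∎
    where
    lemma₁ : ∀ a z b → ℤ.- a ℤ.- z ℤ.* ℤ.- b ≡ ℤ.- a ℤ.+ z ℤ.* b
    lemma₁ = ℤ.solve-∀
  lemma : ∀ z a b j → z ℤ.* a ℤ.+ (ℤ.- ((1ℤ ℤ.+ j) ℤ.* b) ℤ.+ z ℤ.* (j ℤ.* a)) ≡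
                      ℤ.- ((1ℤ ℤ.+ j) ℤ.* (b ℤ.- z ℤ.* a))
  lemma = ℤ.solve-∀

-- The polynomial with the given roots

-- The sequence `g` starts at the leading coefficient, so the coefficients of the product of the
-- `1 - z t` here yield the reversed polynomial, with roots `zs`.
horner : (ℕ → ℤ) → ℕ → ℤ → ℤ
horner g zero    t = g 0
horner g (suc n) t = t ℤ.* horner g n t ℤ.+ g (suc n)

coefficient-vanishes : ∀ (zs : Vec ℤ n) {j} → n < j → coefficient zs j ≡ 0ℤ
coefficient-vanishes []       z<s = refl
coefficient-vanishes (z ∷ zs) {suc j} (s≤s n<j) =
  trans (cong₂ (λ u v → u ℤ.- z ℤ.* v) (coefficient-vanishes zs (ℕ.m<n⇒m<1+n n<j))
                                        (coefficient-vanishes zs n<j))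
        (cong (λ w → 0ℤ ℤ.- w) (ℤ.*-zeroʳ z))

-- The factor `t - z` comes out up to one further coefficient, which vanishes once `j` reaches the
-- length of `zs`.
horner-step : ∀ z (zs : Vec ℤ n) j t →
  horner (coefficient (z ∷ zs)) (suc j) t ≡
  (t ℤ.- z) ℤ.* horner (coefficient zs) j t ℤ.+ coefficient zs (suc j)
horner-step z zs zero t = lemma t z (coefficient zs 1)
  where
  lemma : ∀ t z c → t ℤ.* 1ℤ ℤ.+ (c ℤ.- z ℤ.* 1ℤ) ≡ (t ℤ.- z) ℤ.* 1ℤ ℤ.+ c
  lemma = ℤ.solve-∀
horner-step z zs (suc j) t =
  trans (cong (λ w → t ℤ.* w ℤ.+ coefficient (z ∷ zs) (2 + j)) (horner-step z zs j t))
        (lemma t z _ (coefficient zs (suc j)) (coefficient zs (2 + j)))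
  where
  lemma : ∀ t z h c d → t ℤ.* ((t ℤ.- z) ℤ.* h ℤ.+ c) ℤ.+ (d ℤ.- z ℤ.* c) ≡
                        (t ℤ.- z) ℤ.* (t ℤ.* h ℤ.+ c) ℤ.+ d
  lemma = ℤ.solve-∀

horner-roots : ∀ (zs : Vec ℤ n) t → horner (coefficient zs) n t ≡ Π (λ z → t ℤ.- z) zs
horner-roots []                 t = refl
horner-roots {suc n} (z ∷ zs) t = begin
  horner (coefficient (z ∷ zs)) (suc n) t
    ≡⟨ horner-step z zs n t ⟩
  (t ℤ.- z) ℤ.* horner (coefficient zs) n t ℤ.+ coefficient zs (suc n)
    ≡⟨ cong₂ (λ u v → (t ℤ.- z) ℤ.* u ℤ.+ v) (horner-roots zs t) (coefficient-vanishes zs ℕ.≤-refl) ⟩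
  (t ℤ.- z) ℤ.* Π (λ z → t ℤ.- z) zs ℤ.+ 0ℤ
    ≡⟨ ℤ.+-identityʳ _ ⟩
  (t ℤ.- z) ℤ.* Π (λ z → t ℤ.- z) zs ∎
  where open ≡-Reasoning

-- Even polynomials and vanishing odd coefficients

parity : ∀ l → (∃ λ a → l ≡ 2 * a) ⊎ (∃ λ a → l ≡ suc (2 * a))
parity zero = inj₁ (0 , refl)
parity (suc l) with parity l
... | inj₁ (a , refl) = inj₂ (a , refl)
... | inj₂ (a , refl) = inj₁ (suc a , lemma a)
  where
  lemma : ∀ a → 2 + 2 * a ≡ 2 * suc a
  lemma = ℕ.solve-∀

even≢odd : ∀ a b → 2 * a ≢ suc (2 * b)
even≢odd zero    b       ()
even≢odd (suc a) zero    eq = contradiction (ℕ.suc-injective (trans (sym (ℕ.*-suc 2 a)) eq)) λ ()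
even≢odd (suc a) (suc b) eq =
  even≢odd a b (ℕ.suc-injective (ℕ.suc-injective
    (trans (sym (ℕ.*-suc 2 a)) (trans eq (cong suc (ℕ.*-suc 2 b))))))

convolution-zero : ∀ f g n → (∀ l l′ → l + l′ ≡ n → f l ℤ.* g l′ ≡ 0ℤ) → convolution f g n ≡ 0ℤ
convolution-zero f g zero    z = z 0 0 refl
convolution-zero f g (suc n) z =
  cong₂ ℤ._+_ (z 0 (suc n) refl) (convolution-zero (f ∘ suc) g n λ l l′ eq → z (suc l) l′ (cong suc eq))

-- Strong induction through Newton's identity at the even index `2 * i`: in each product either the
-- power sum has odd exponent and is zero, or both indices are odd and the coefficient vanishes by
-- induction. The factor `2 i + 1` then cancels.
odd-coefficients-vanish : ∀ (zs : Vec ℤ n) m → (∀ i → i < m → powerSum (suc (2 * i)) zs ≡ 0ℤ) →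
                          ∀ i → i < m → coefficient zs (suc (2 * i)) ≡ 0ℤ
odd-coefficients-vanish zs m p≡0 = <-rec _ go
  where
  go : ∀ i → (∀ {a} → a < i → a < m → coefficient zs (suc (2 * a)) ≡ 0ℤ) →
       i < m → coefficient zs (suc (2 * i)) ≡ 0ℤ
  go i rec i<m = ℤ.*-cancelˡ-≡ (+ suc (2 * i)) _ 0ℤ
    (trans (ℤ.neg-injective (trans (sym (newton zs (2 * i))) (convolution-zero _ _ (2 * i) term)))
           (sym (ℤ.*-zeroʳ (+ suc (2 * i)))))
    where
    term : ∀ l l′ → l + l′ ≡ 2 * i → powerSum (suc l) zs ℤ.* coefficient zs l′ ≡ 0ℤ
    term l l′ eq with parity l
    ... | inj₁ (a , refl) =
      cong (ℤ._* coefficient zs l′)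
        (p≡0 a (ℕ.≤-<-trans (ℕ.*-cancelˡ-≤ 2 (subst (2 * a ≤_) eq (ℕ.m≤m+n (2 * a) l′))) i<m))
    ... | inj₂ (a , refl) with parity l′
    ...   | inj₁ (b , refl) =
      contradiction (trans (sym eq) (cong suc (sym (ℕ.*-distribˡ-+ 2 a b)))) (even≢odd i (a + b))
    ...   | inj₂ (b , refl) =
      trans (cong (powerSum (2 + 2 * a) zs ℤ.*_) (rec b<i (ℕ.<-trans b<i i<m)))
            (ℤ.*-zeroʳ (powerSum (2 + 2 * a) zs))
      where
      lemma : ∀ a b → suc (2 * a) + suc (2 * b) ≡ 2 * suc (a + b)
      lemma = ℕ.solve-∀
      b<i : b < i
      b<i = subst (b <_) (ℕ.*-cancelˡ-≡ _ _ 2 (trans (sym (lemma a b)) eq)) (s≤s (ℕ.m≤n+m b a))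

-- Two Horner steps turn an even `h(t)` into `t^2 h(t) + e t + c`, whose only odd term is the linear
-- one.
horner-almost-even-step : ∀ g m →
  (∀ t → horner g (2 * m) (ℤ.- t) ≡ horner g (2 * m) t) →
  ∀ t → horner g (2 + 2 * m) t ≡
        horner g (2 + 2 * m) (ℤ.- t) ℤ.+ (g (suc (2 * m)) ℤ.+ g (suc (2 * m))) ℤ.* t
horner-almost-even-step g m even t =
  trans (lemma t (horner g (2 * m) t) (g (suc (2 * m))) (g (2 + 2 * m)))
        (cong (λ w → ((ℤ.- t) ℤ.* ((ℤ.- t) ℤ.* w ℤ.+ g (suc (2 * m))) ℤ.+ g (2 + 2 * m))
                       ℤ.+ (g (suc (2 * m)) ℤ.+ g (suc (2 * m))) ℤ.* t) (sym (even t)))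
  where
  lemma : ∀ t h e c → t ℤ.* (t ℤ.* h ℤ.+ e) ℤ.+ c ≡
    ((ℤ.- t) ℤ.* ((ℤ.- t) ℤ.* h ℤ.+ e) ℤ.+ c) ℤ.+ (e ℤ.+ e) ℤ.* t
  lemma = ℤ.solve-∀

horner-even : ∀ g m → (∀ i → i < m → g (suc (2 * i)) ≡ 0ℤ) →
              ∀ t → horner g (2 * m) (ℤ.- t) ≡ horner g (2 * m) t
horner-even g zero    g≡0 t = refl
horner-even g (suc m) g≡0 t =
  subst (λ d → horner g d (ℤ.- t) ≡ horner g d t) (sym (ℕ.*-suc 2 m)) (sym (begin
    horner g (2 + 2 * m) t
      ≡⟨ horner-almost-even-step g m (horner-even g m λ i i<m → g≡0 i (ℕ.m<n⇒m<1+n i<m)) t ⟩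
    horner g (2 + 2 * m) (ℤ.- t) ℤ.+ (g (suc (2 * m)) ℤ.+ g (suc (2 * m))) ℤ.* t
      ≡⟨ cong (λ e → horner g (2 + 2 * m) (ℤ.- t) ℤ.+ (e ℤ.+ e) ℤ.* t) (g≡0 m ℕ.≤-refl) ⟩
    horner g (2 + 2 * m) (ℤ.- t) ℤ.+ 0ℤ
      ≡⟨ ℤ.+-identityʳ _ ⟩
    horner g (2 + 2 * m) (ℤ.- t) ∎))
  where open ≡-Reasoning

horner-almost-even : ∀ g m → (∀ i → i < m → g (suc (2 * i)) ≡ 0ℤ) →
  ∀ t → horner g (2 + 2 * m) t ≡
        horner g (2 + 2 * m) (ℤ.- t) ℤ.+ (g (suc (2 * m)) ℤ.+ g (suc (2 * m))) ℤ.* t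
horner-almost-even g m g≡0 = horner-almost-even-step g m (horner-even g m g≡0)

-- Rules for finite products

Π-cong : ∀ {f g} (xs : Vec ℤ n) → (∀ i → f (lookup xs i) ≡ g (lookup xs i)) → Π f xs ≡ Π g xs
Π-cong []       eq = refl
Π-cong (x ∷ xs) eq = cong₂ ℤ._*_ (eq zero) (Π-cong xs (eq ∘ suc))

Π-* : ∀ f g (xs : Vec ℤ n) → Π (λ x → f x ℤ.* g x) xs ≡ Π f xs ℤ.* Π g xs
Π-* f g []       = refl
Π-* f g (x ∷ xs) = trans (cong (f x ℤ.* g x ℤ.*_) (Π-* f g xs)) (lemma (f x) (g x) _ _)
  where
  lemma : ∀ a b c d → a ℤ.* b ℤ.* (c ℤ.* d) ≡ a ℤ.* c ℤ.* (b ℤ.* d)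
  lemma = ℤ.solve-∀

Π-const : ∀ c (xs : Vec ℤ n) → Π (λ _ → c) xs ≡ c ℤ.^ n
Π-const c []       = refl
Π-const c (x ∷ xs) = cong (c ℤ.*_) (Π-const c xs)

Π-++ : ∀ f (xs : Vec ℤ m) (ys : Vec ℤ n) → Π f (xs ++ ys) ≡ Π f xs ℤ.* Π f ys
Π-++ f []       ys = sym (ℤ.*-identityˡ _)
Π-++ f (x ∷ xs) ys = trans (cong (f x ℤ.*_) (Π-++ f xs ys)) (sym (ℤ.*-assoc (f x) _ _))

Π-map : ∀ f g (xs : Vec ℤ n) → Π f (Vec.map g xs) ≡ Π (f ∘ g) xs
Π-map f g []       = refl
Π-map f g (x ∷ xs) = cong (f (g x) ℤ.*_) (Π-map f g xs)

Π-swap : ∀ (f : ℤ → ℤ → ℤ) (xs : Vec ℤ m) (ys : Vec ℤ n) →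
         Π (λ x → Π (f x) ys) xs ≡ Π (λ y → Π (λ x → f x y) xs) ys
Π-swap {n = n} f [] ys = sym (trans (Π-const 1ℤ ys) (ℤ.^-zeroˡ n))
Π-swap f (x ∷ xs) ys =
  trans (cong (Π (f x) ys ℤ.*_) (Π-swap f xs ys)) (sym (Π-* (f x) (λ y → Π (λ x → f x y) xs) ys))

∣Π∣-cong : ∀ {f g} (xs : Vec ℤ n) → (∀ x → ∣ f x ∣ ≡ ∣ g x ∣) → ∣ Π f xs ∣ ≡ ∣ Π g xs ∣
∣Π∣-cong                 []       eq = refl
∣Π∣-cong {f = f} {g} (x ∷ xs) eq =
  trans (ℤ.abs-* (f x) _) (trans (cong₂ _*_ (eq x) (∣Π∣-cong xs eq)) (sym (ℤ.abs-* (g x) _)))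

Π-zero⁺ : ∀ f (xs : Vec ℤ n) i → f (lookup xs i) ≡ 0ℤ → Π f xs ≡ 0ℤ
Π-zero⁺ f (x ∷ xs) zero    eq = cong (ℤ._* Π f xs) eq
Π-zero⁺ f (x ∷ xs) (suc i) eq = trans (cong (f x ℤ.*_) (Π-zero⁺ f xs i eq)) (ℤ.*-zeroʳ (f x))

Π-zero⁻ : ∀ f (xs : Vec ℤ n) → Π f xs ≡ 0ℤ → ∃ λ i → f (lookup xs i) ≡ 0ℤ
Π-zero⁻ f (x ∷ xs) eq with ℤ.i*j≡0⇒i≡0∨j≡0 (f x) eq
... | inj₁ fx≡0 = zero , fx≡0
... | inj₂ rest with i , p ← Π-zero⁻ f xs rest = suc i , p

-- Power sums

odd-neg : ∀ v j → (ℤ.- v) ℤ.^ suc (2 * j) ≡ ℤ.- (v ℤ.^ suc (2 * j))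
odd-neg v zero    = lemma v
  where
  lemma : ∀ v → (ℤ.- v) ℤ.* 1ℤ ≡ ℤ.- (v ℤ.* 1ℤ)
  lemma = ℤ.solve-∀
odd-neg v (suc j) =
  subst (λ d → (ℤ.- v) ℤ.^ suc d ≡ ℤ.- (v ℤ.^ suc d)) (sym (ℕ.*-suc 2 j))
    (trans (cong (λ w → (ℤ.- v) ℤ.* ((ℤ.- v) ℤ.* w)) (odd-neg v j)) (lemma v (v ℤ.^ suc (2 * j))))
  where
  lemma : ∀ v w → (ℤ.- v) ℤ.* ((ℤ.- v) ℤ.* ℤ.- w) ≡ ℤ.- (v ℤ.* (v ℤ.* w))
  lemma = ℤ.solve-∀

powerSum-++ : ∀ e (xs : Vec ℤ m) (ys : Vec ℤ n) →
              powerSum e (xs ++ ys) ≡ powerSum e xs ℤ.+ powerSum e ys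
powerSum-++ e []       ys = sym (ℤ.+-identityˡ _)
powerSum-++ e (x ∷ xs) ys =
  trans (cong (λ w → x ℤ.^ e ℤ.+ w) (powerSum-++ e xs ys)) (sym (ℤ.+-assoc (x ℤ.^ e) _ _))

odd-powerSum-neg : ∀ j (xs : Vec ℤ n) →
  powerSum (suc (2 * j)) (Vec.map ℤ.-_ xs) ≡ ℤ.- powerSum (suc (2 * j)) xs
odd-powerSum-neg j []       = refl
odd-powerSum-neg j (x ∷ xs) =
  trans (cong₂ ℤ._+_ (odd-neg x j) (odd-powerSum-neg j xs))
        (sym (ℤ.neg-distrib-+ (x ℤ.^ suc (2 * j)) _))

powerSum-zeros : ∀ e n → powerSum (suc e) (replicate n 0ℤ) ≡ 0ℤ
powerSum-zeros e zero    = refl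
powerSum-zeros e (suc n) = trans (ℤ.+-identityˡ _) (powerSum-zeros e n)

-- Solutions of one odd power system with no two entries summing to zero

-- With i ≡ j this includes that no entry is zero.
Core : Vec ℤ n → Set
Core x = ∀ i j → lookup x i ℤ.+ lookup x j ≢ 0ℤ

-- Odd powers change sign with the base, so the negated `y` contributes the negative of the
-- right-hand sides. The zeros adjust the number of roots without affecting these power sums.
powerSums-cancel : ∀ {h : Vec ℤ k} (x : Vec ℤ m) (y : Vec ℤ n) pad →
  OddPowerSystem h x → OddPowerSystem h y → ∀ i → i < k →
  powerSum (suc (2 * i)) (x ++ (Vec.map ℤ.-_ y ++ replicate pad 0ℤ)) ≡ 0ℤ
powerSums-cancel {h = h} x y pad sx sy i i<k = begin
  powerSum e (x ++ (Vec.map ℤ.-_ y ++ replicate pad 0ℤ))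
    ≡⟨ trans (powerSum-++ e x _) (cong (λ w → powerSum e x ℤ.+ w) (powerSum-++ e (Vec.map ℤ.-_ y) _)) ⟩
  powerSum e x ℤ.+ (powerSum e (Vec.map ℤ.-_ y) ℤ.+ powerSum e (replicate pad 0ℤ))
    ≡⟨ cong₂ (λ u v → powerSum e x ℤ.+ (u ℤ.+ v)) (odd-powerSum-neg i y) (powerSum-zeros (2 * i) pad) ⟩
  powerSum e x ℤ.+ (ℤ.- powerSum e y ℤ.+ 0ℤ)
    ≡⟨ cong₂ (λ u v → u ℤ.+ (ℤ.- v ℤ.+ 0ℤ)) (at x sx) (at y sy) ⟩
  c ℤ.+ (ℤ.- c ℤ.+ 0ℤ)
    ≡⟨ cong (λ w → c ℤ.+ w) (ℤ.+-identityʳ (ℤ.- c)) ⟩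
  c ℤ.+ ℤ.- c
    ≡⟨ ℤ.+-inverseʳ c ⟩
  0ℤ ∎
  where
  open ≡-Reasoning
  e = suc (2 * i)
  c = lookup h (fromℕ< i<k)
  at : ∀ {l} (z : Vec ℤ l) → OddPowerSystem h z → powerSum e z ≡ c
  at z sz = subst (λ i → powerSum (suc (2 * i)) z ≡ c) (Fin.toℕ-fromℕ< i<k) (sz (fromℕ< i<k))

-- The product of all t - xᵢ and t + yⱼ is an even polynomial, so that with
-- xᵢ also - xᵢ is one of its roots.
short-cores-agree : ∀ {h : Vec ℤ k} (x : Vec ℤ m) (y : Vec ℤ n) → m + n ≤ 2 * k →
  OddPowerSystem h x → OddPowerSystem h y → Core x →
  ∀ i → ∃ λ j → lookup y j ≡ lookup x i
short-cores-agree {k = k} {m} {n} {h} x y len sx sy core i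
  with ℤ.i*j≡0⇒i≡0∨j≡0 (Π (λ z → ℤ.- a ℤ.- z) x) -a-root
  where
  a = lookup x i
  -- The padding raises the degree to exactly `2 * k`, where the `k` equations annihilate every odd
  -- coefficient.
  pad = 2 * k ∸ (m + n)
  zs = x ++ (Vec.map ℤ.-_ y ++ replicate pad 0ℤ)
  length-zs : m + (n + pad) ≡ 2 * k
  length-zs = trans (sym (ℕ.+-assoc m n pad)) (ℕ.m+[n∸m]≡n len)
  even : Π (λ z → ℤ.- a ℤ.- z) zs ≡ Π (λ z → a ℤ.- z) zs
  even = trans (sym (horner-roots zs (ℤ.- a))) (trans
    (subst (λ d → horner (coefficient zs) d (ℤ.- a) ≡ horner (coefficient zs) d a) (sym length-zs)
      (horner-even (coefficient zs) k
        (odd-coefficients-vanish zs k (powerSums-cancel {h = h} x y pad sx sy)) a))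
    (horner-roots zs a))
  -a-root : Π (λ z → ℤ.- a ℤ.- z) x ℤ.*
            Π (λ z → ℤ.- a ℤ.- z) (Vec.map ℤ.-_ y ++ replicate pad 0ℤ) ≡ 0ℤ
  -a-root = trans (sym (Π-++ (λ z → ℤ.- a ℤ.- z) x _)) (trans even
    (trans (Π-++ (λ z → a ℤ.- z) x _)
           (cong (λ w → w ℤ.* Π (λ z → a ℤ.- z) (Vec.map ℤ.-_ y ++ replicate pad 0ℤ))
                 (Π-zero⁺ (λ z → a ℤ.- z) x i (ℤ.+-inverseʳ a)))))
... | inj₁ eq with j , p ← Π-zero⁻ _ x eq =
  contradiction (trans (lemma (lookup x i) (lookup x j)) (cong ℤ.-_ p)) (core i j)
  where
  lemma : ∀ a b → a ℤ.+ b ≡ ℤ.- (ℤ.- a ℤ.- b)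
  lemma = ℤ.solve-∀
... | inj₂ eq
  with ℤ.i*j≡0⇒i≡0∨j≡0 (Π (λ z → ℤ.- lookup x i ℤ.- z) (Vec.map ℤ.-_ y))
         (trans (sym (Π-++ _ (Vec.map ℤ.-_ y) _)) eq)
... | inj₁ eq′ with j , p ← Π-zero⁻ _ y (trans (sym (Π-map _ ℤ.-_ y)) eq′) =
  j , ℤ.i-j≡0⇒i≡j _ _ (trans (lemma (lookup x i) (lookup y j)) p)
  where
  lemma : ∀ a b → b ℤ.- a ≡ ℤ.- a ℤ.- ℤ.- b
  lemma = ℤ.solve-∀
-- If `- xᵢ` is one of the padding zeros, then `xᵢ` is zero, which the diagonal case of `Core`
-- excludes.
... | inj₂ eq′ with j , p ← Π-zero⁻ _ (replicate (2 * k ∸ (m + n)) 0ℤ) eq′ =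
  contradiction (cong₂ ℤ._+_ a≡0 a≡0) (core i i)
  where
  a≡0 : lookup x i ≡ 0ℤ
  a≡0 = ℤ.neg-injective (trans (sym (ℤ.+-identityʳ _))
    (trans (cong (λ w → ℤ.- lookup x i ℤ.- w) (sym (Vec.lookup-replicate j 0ℤ))) p))

-- Products of pair sums and the resultant

pairSums : Vec ℤ n → ℤ
pairSums []       = 1ℤ
pairSums (x ∷ xs) = Π (λ y → x ℤ.+ y) xs ℤ.* pairSums xs

-- The ordered pairs of positions consist of the diagonal and of every pair `i < j` twice.
pairSums-square : ∀ (x : Vec ℤ n) →
  Π (λ a → Π (λ b → a ℤ.+ b) x) x ≡ Π (λ a → a ℤ.+ a) x ℤ.* (pairSums x ℤ.* pairSums x)
pairSums-square []       = refl
pairSums-square (x ∷ xs) = begin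
  (x ℤ.+ x) ℤ.* p ℤ.* Π (λ a → (a ℤ.+ x) ℤ.* Π (λ b → a ℤ.+ b) xs) xs
    ≡⟨ cong ((x ℤ.+ x) ℤ.* p ℤ.*_) (Π-* (λ a → a ℤ.+ x) (λ a → Π (λ b → a ℤ.+ b) xs) xs) ⟩
  (x ℤ.+ x) ℤ.* p ℤ.* (Π (λ a → a ℤ.+ x) xs ℤ.* Π (λ a → Π (λ b → a ℤ.+ b) xs) xs)
    ≡⟨ cong₂ (λ u v → (x ℤ.+ x) ℤ.* p ℤ.* (u ℤ.* v))
         (Π-cong xs λ i → ℤ.+-comm (lookup xs i) x) (pairSums-square xs) ⟩
  (x ℤ.+ x) ℤ.* p ℤ.* (p ℤ.* (Π (λ a → a ℤ.+ a) xs ℤ.* (pairSums xs ℤ.* pairSums xs)))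
    ≡⟨ lemma (x ℤ.+ x) p _ (pairSums xs) ⟩
  (x ℤ.+ x) ℤ.* Π (λ a → a ℤ.+ a) xs ℤ.* (p ℤ.* pairSums xs ℤ.* (p ℤ.* pairSums xs)) ∎
  where
  open ≡-Reasoning
  p = Π (λ y → x ℤ.+ y) xs
  lemma : ∀ t p d q → t ℤ.* p ℤ.* (p ℤ.* (d ℤ.* (q ℤ.* q))) ≡ t ℤ.* d ℤ.* (p ℤ.* q ℤ.* (p ℤ.* q))
  lemma = ℤ.solve-∀

∣Π : ∀ f (xs : Vec ℤ n) i → ∣ f (lookup xs i) ∣ ∣ ∣ Π f xs ∣
∣Π f (x ∷ xs) zero    rewrite ℤ.abs-* (f x) (Π f xs) = m∣m*n _
∣Π f (x ∷ xs) (suc i) rewrite ℤ.abs-* (f x) (Π f xs) = ∣n⇒∣m*n ∣ f x ∣ (∣Π f xs i)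

∣pairSums : ∀ (x : Vec ℤ n) i j → i ≢ j → ∣ lookup x i ℤ.+ lookup x j ∣ ∣ ∣ pairSums x ∣
∣pairSums (x ∷ xs) zero    zero    i≢j = contradiction refl i≢j
∣pairSums (x ∷ xs) zero    (suc j) i≢j
  rewrite ℤ.abs-* (Π (λ y → x ℤ.+ y) xs) (pairSums xs) = ∣m⇒∣m*n _ (∣Π (λ y → x ℤ.+ y) xs j)
∣pairSums (x ∷ xs) (suc i) zero    i≢j
  rewrite ℤ.abs-* (Π (λ y → x ℤ.+ y) xs) (pairSums xs) | ℤ.+-comm (lookup xs i) x =
  ∣m⇒∣m*n _ (∣Π (λ y → x ℤ.+ y) xs i)
∣pairSums (x ∷ xs) (suc i) (suc j) i≢j
  rewrite ℤ.abs-* (Π (λ y → x ℤ.+ y) xs) (pairSums xs) =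
  ∣n⇒∣m*n ∣ Π (λ y → x ℤ.+ y) xs ∣ (∣pairSums xs i j (i≢j ∘ cong suc))

-- The odd part of the product of all t - xᵢ and t + yⱼ is e t.
AlmostEven : Vec ℤ n → Vec ℤ n → ℤ → Set
AlmostEven x y e = ∀ t →
  Π (λ a → t ℤ.- a) x ℤ.* Π (λ b → t ℤ.+ b) y ≡
  Π (λ a → t ℤ.+ a) x ℤ.* Π (λ b → t ℤ.- b) y ℤ.+ (e ℤ.+ e) ℤ.* t

almostEven-sym : ∀ (x y : Vec ℤ n) {e} → AlmostEven x y e → AlmostEven y x (ℤ.- e)
almostEven-sym x y {e} eq t =
  trans (lemma₁ (Π (λ b → t ℤ.- b) y) (Π (λ a → t ℤ.+ a) x) e t)
    (trans (cong (λ w → w ℤ.+ (ℤ.- e ℤ.+ ℤ.- e) ℤ.* t) (sym (eq t)))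
    (cong (λ w → w ℤ.+ (ℤ.- e ℤ.+ ℤ.- e) ℤ.* t) (ℤ.*-comm (Π (λ a → t ℤ.- a) x) _)))
  where
  lemma₁ : ∀ u v e t → u ℤ.* v ≡ v ℤ.* u ℤ.+ (e ℤ.+ e) ℤ.* t ℤ.+ (ℤ.- e ℤ.+ ℤ.- e) ℤ.* t
  lemma₁ = ℤ.solve-∀

-- The polynomial has degree `2 k + 2`, and the `k` equations remove the coefficients of odd index
-- below `2 k`. The one left, at index `2 k + 1`, belongs to `t` itself and is `e`.
almostEven : ∀ {h : Vec ℤ k} (x y : Vec ℤ (suc k)) →
             OddPowerSystem h x → OddPowerSystem h y → ∃ (AlmostEven x y)
almostEven {k = k} {h} x y sx sy = coefficient zs (suc (2 * k)) , λ t → begin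
  Π (λ a → t ℤ.- a) x ℤ.* Π (λ b → t ℤ.+ b) y
    ≡⟨ split t ⟨
  Π (λ z → t ℤ.- z) zs
    ≡⟨ horner-roots zs t ⟨
  horner (coefficient zs) (suc k + (suc k + 0)) t
    ≡⟨ cong (λ d → horner (coefficient zs) d t) length-zs ⟩
  horner (coefficient zs) (2 + 2 * k) t
    ≡⟨ horner-almost-even (coefficient zs) k
         (odd-coefficients-vanish zs k (powerSums-cancel {h = h} x y 0 sx sy)) t ⟩
  horner (coefficient zs) (2 + 2 * k) (ℤ.- t) ℤ.+ rest t
    ≡⟨ cong (λ d → horner (coefficient zs) d (ℤ.- t) ℤ.+ rest t) (sym length-zs) ⟩
  horner (coefficient zs) (suc k + (suc k + 0)) (ℤ.- t) ℤ.+ rest t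
    ≡⟨ cong (λ w → w ℤ.+ rest t) (trans (horner-roots zs (ℤ.- t)) (trans (split (ℤ.- t)) (flip t x y))) ⟩
  Π (λ a → t ℤ.+ a) x ℤ.* Π (λ b → t ℤ.- b) y ℤ.+ rest t ∎
  where
  open ≡-Reasoning
  -- The number of roots is already even, so the padding is empty.
  zs = x ++ (Vec.map ℤ.-_ y ++ replicate 0 0ℤ)
  rest : ℤ → ℤ
  rest t = (coefficient zs (suc (2 * k)) ℤ.+ coefficient zs (suc (2 * k))) ℤ.* t
  length-zs : suc k + (suc k + 0) ≡ 2 + 2 * k
  length-zs = ℕ.*-suc 2 k
  split : ∀ t → Π (λ z → t ℤ.- z) zs ≡ Π (λ a → t ℤ.- a) x ℤ.* Π (λ b → t ℤ.+ b) y
  split t = trans (Π-++ (λ z → t ℤ.- z) x _) (cong (Π (λ a → t ℤ.- a) x ℤ.*_)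
    (trans (Π-++ (λ z → t ℤ.- z) (Vec.map ℤ.-_ y) _) (trans (ℤ.*-identityʳ _)
      (trans (Π-map (λ z → t ℤ.- z) ℤ.-_ y)
        (Π-cong y λ i → cong (λ w → t ℤ.+ w) (ℤ.neg-involutive (lookup y i)))))))
  -- Both vectors have the same length, so the sign changes cancel in pairs.
  flip : ∀ {n} t (x y : Vec ℤ n) → Π (λ a → ℤ.- t ℤ.- a) x ℤ.* Π (λ b → ℤ.- t ℤ.+ b) y ≡
                                   Π (λ a → t ℤ.+ a) x ℤ.* Π (λ b → t ℤ.- b) y
  flip t []       []       = refl
  flip t (a ∷ as) (b ∷ bs) = trans (lemma₁ t a b _ _) (trans
    (cong ((t ℤ.+ a) ℤ.* (t ℤ.- b) ℤ.*_) (flip t as bs)) (lemma₂ (t ℤ.+ a) (t ℤ.- b) _ _))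
    where
    lemma₁ : ∀ t a b u v → (ℤ.- t ℤ.- a) ℤ.* u ℤ.* ((ℤ.- t ℤ.+ b) ℤ.* v) ≡
                           (t ℤ.+ a) ℤ.* (t ℤ.- b) ℤ.* (u ℤ.* v)
    lemma₁ = ℤ.solve-∀
    lemma₂ : ∀ c d u v → c ℤ.* d ℤ.* (u ℤ.* v) ≡ c ℤ.* u ℤ.* (d ℤ.* v)
    lemma₂ = ℤ.solve-∀

-- At an entry of `x` the left-hand side of `AlmostEven` vanishes, which determines the product on
-- the right.
almostEven-root : ∀ (x y : Vec ℤ n) {e} → AlmostEven x y e → ∀ i → let a = lookup x i in
  Π (λ b → a ℤ.+ b) x ℤ.* Π (λ b → a ℤ.- b) y ≡ (ℤ.- e) ℤ.* (a ℤ.+ a)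
almostEven-root x y {e} eq i = begin
  p                                                ≡⟨ lemma p e a ⟩
  p ℤ.+ (e ℤ.+ e) ℤ.* a ℤ.+ ℤ.- e ℤ.* (a ℤ.+ a)    ≡⟨ cong (λ w → w ℤ.+ ℤ.- e ℤ.* (a ℤ.+ a)) vanishes ⟩
  0ℤ ℤ.+ ℤ.- e ℤ.* (a ℤ.+ a)                       ≡⟨ ℤ.+-identityˡ _ ⟩
  ℤ.- e ℤ.* (a ℤ.+ a)                              ∎
  where
  open ≡-Reasoning
  a = lookup x i
  p = Π (λ b → a ℤ.+ b) x ℤ.* Π (λ b → a ℤ.- b) y
  vanishes : p ℤ.+ (e ℤ.+ e) ℤ.* a ≡ 0ℤ
  vanishes = trans (sym (eq a))
    (cong (ℤ._* Π (λ b → a ℤ.+ b) y) (Π-zero⁺ (λ b → a ℤ.- b) x i (ℤ.+-inverseʳ a)))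
  lemma : ∀ u e a → u ≡ u ℤ.+ (e ℤ.+ e) ℤ.* a ℤ.+ ℤ.- e ℤ.* (a ℤ.+ a)
  lemma = ℤ.solve-∀

-- With `e = 0` the product in `almostEven-root` is zero, so `xᵢ` is opposite to an entry of `x`,
-- which a core forbids, or equal to an entry of `y`.
even-cores-agree : ∀ (x y : Vec ℤ n) → AlmostEven x y 0ℤ → Core x →
                   ∀ i → ∃ λ j → lookup y j ≡ lookup x i
even-cores-agree x y eq core i
  with ℤ.i*j≡0⇒i≡0∨j≡0 (Π (λ b → lookup x i ℤ.+ b) x) (almostEven-root x y {0ℤ} eq i)
... | inj₁ p with j , q ← Π-zero⁻ _ x p = contradiction q (core i j)
... | inj₂ p with j , q ← Π-zero⁻ _ y p = j , sym (ℤ.i-j≡0⇒i≡j (lookup x i) (lookup y j) q)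

-- Multiply `almostEven-root` over all entries of `x`. The diagonal factors `a + a` appear on both
-- sides and are nonzero for a core. The remaining double product is the resultant of the
-- polynomials with roots `x` and `y`.
pairSums-resultant : ∀ (x y : Vec ℤ n) {e} → AlmostEven x y e → Core x →
  (pairSums x ℤ.* pairSums x) ℤ.* Π (λ a → Π (λ b → a ℤ.- b) y) x ≡ (ℤ.- e) ℤ.^ n
pairSums-resultant {n} x y {e} eq core = ℤ.*-cancelˡ-≡ (Π (λ a → a ℤ.+ a) x) _ _ {{ℤ.≢-nonZero nonzero}} (begin
  Π (λ a → a ℤ.+ a) x ℤ.* ((pairSums x ℤ.* pairSums x) ℤ.* r)
    ≡⟨ ℤ.*-assoc (Π (λ a → a ℤ.+ a) x) _ r ⟨
  Π (λ a → a ℤ.+ a) x ℤ.* (pairSums x ℤ.* pairSums x) ℤ.* r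
    ≡⟨ cong (ℤ._* r) (pairSums-square x) ⟨
  Π (λ a → Π (λ b → a ℤ.+ b) x) x ℤ.* r
    ≡⟨ Π-* (λ a → Π (λ b → a ℤ.+ b) x) (λ a → Π (λ b → a ℤ.- b) y) x ⟨
  Π (λ a → Π (λ b → a ℤ.+ b) x ℤ.* Π (λ b → a ℤ.- b) y) x
    ≡⟨ Π-cong x (almostEven-root x y {e} eq) ⟩
  Π (λ a → (ℤ.- e) ℤ.* (a ℤ.+ a)) x
    ≡⟨ Π-* (λ _ → ℤ.- e) (λ a → a ℤ.+ a) x ⟩
  Π (λ _ → ℤ.- e) x ℤ.* Π (λ a → a ℤ.+ a) x
    ≡⟨ cong (ℤ._* Π (λ a → a ℤ.+ a) x) (Π-const (ℤ.- e) x) ⟩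
  (ℤ.- e) ℤ.^ n ℤ.* Π (λ a → a ℤ.+ a) x
    ≡⟨ ℤ.*-comm ((ℤ.- e) ℤ.^ n) _ ⟩
  Π (λ a → a ℤ.+ a) x ℤ.* (ℤ.- e) ℤ.^ n ∎)
  where
  open ≡-Reasoning
  r = Π (λ a → Π (λ b → a ℤ.- b) y) x
  nonzero : Π (λ a → a ℤ.+ a) x ≢ 0ℤ
  nonzero p with i , q ← Π-zero⁻ _ x p = core i i q

∣^∣ : ∀ i n → ∣ i ℤ.^ n ∣ ≡ ∣ i ∣ ^ n
∣^∣ i zero    = refl
∣^∣ i (suc n) = trans (ℤ.abs-* i (i ℤ.^ n)) (cong (∣ i ∣ *_) (∣^∣ i n))

square-injective : ∀ {a b} → a * a ≡ b * b → a ≡ b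
square-injective {a} {b} eq with ℕ.<-cmp a b
... | tri< a<b _ _ = contradiction eq (ℕ.<⇒≢ (ℕ.*-mono-< a<b a<b))
... | tri≈ _ p _   = p
... | tri> _ _ b<a = contradiction (sym eq) (ℕ.<⇒≢ (ℕ.*-mono-< b<a b<a))

-- Exchanging `x` and `y` changes the resultant and `e` at most in sign. The resultant is nonzero
-- because its multiple `(- e)^n` is, so it cancels.
pairSums-unique : ∀ (x y : Vec ℤ n) {e} → AlmostEven x y e → e ≢ 0ℤ → Core x → Core y →
                  ∣ pairSums x ∣ ≡ ∣ pairSums y ∣
pairSums-unique {n} x y {e} eq e≢0 cx cy =
  square-injective (ℕ.*-cancelʳ-≡ _ _ ∣ r ∣ {{≢-nonZero r≢0}} (begin
    ∣ pairSums x ∣ * ∣ pairSums x ∣ * ∣ r ∣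
      ≡⟨ abs x r ⟩
    ∣ pairSums x ℤ.* pairSums x ℤ.* r ∣
      ≡⟨ trans (cong ∣_∣ (pairSums-resultant x y {e} eq cx)) (∣^∣ (ℤ.- e) n) ⟩
    ∣ ℤ.- e ∣ ^ n
      ≡⟨ cong (_^ n) (sym (ℤ.∣-i∣≡∣i∣ (ℤ.- e))) ⟩
    ∣ ℤ.- ℤ.- e ∣ ^ n
      ≡⟨ trans (cong ∣_∣ (pairSums-resultant y x {ℤ.- e} (almostEven-sym x y {e} eq) cy)) (∣^∣ (ℤ.- ℤ.- e) n) ⟨
    ∣ pairSums y ℤ.* pairSums y ℤ.* r′ ∣
      ≡⟨ abs y r′ ⟨
    ∣ pairSums y ∣ * ∣ pairSums y ∣ * ∣ r′ ∣
      ≡⟨ cong (∣ pairSums y ∣ * ∣ pairSums y ∣ *_) r≡r′ ⟨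
    ∣ pairSums y ∣ * ∣ pairSums y ∣ * ∣ r ∣ ∎))
  where
  open ≡-Reasoning
  r  = Π (λ a → Π (λ b → a ℤ.- b) y) x
  r′ = Π (λ b → Π (λ a → b ℤ.- a) x) y
  abs : ∀ (x : Vec ℤ n) r → ∣ pairSums x ∣ * ∣ pairSums x ∣ * ∣ r ∣ ≡ ∣ pairSums x ℤ.* pairSums x ℤ.* r ∣
  abs x r = sym (trans (ℤ.abs-* (pairSums x ℤ.* pairSums x) r)
                       (cong (_* ∣ r ∣) (ℤ.abs-* (pairSums x) (pairSums x))))
  r≡r′ : ∣ r ∣ ≡ ∣ r′ ∣
  r≡r′ = trans (∣Π∣-cong x λ a → ∣Π∣-cong y λ b → ℤ.∣i-j∣≡∣j-i∣ a b)
               (cong ∣_∣ (Π-swap (λ a b → b ℤ.- a) x y))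
  r≢0 : ∣ r ∣ ≢ 0
  r≢0 p = e≢0 (ℤ.neg-injective (ℤ.i^n≡0⇒i≡0 (ℤ.- e) n (trans (sym (pairSums-resultant x y {e} eq cx))
    (trans (cong (pairSums x ℤ.* pairSums x ℤ.*_) (ℤ.∣i∣≡0⇒i≡0 p)) (ℤ.*-zeroʳ (pairSums x ℤ.* pairSums x))))))

-- The divisor bound

^-distribʳ-* : ∀ a b n → (a * b) ^ n ≡ a ^ n * b ^ n
^-distribʳ-* a b zero    = refl
^-distribʳ-* a b (suc n) rewrite ^-distribʳ-* a b n = lemma a b (a ^ n) (b ^ n)
  where
  lemma : ∀ a b c d → a * b * (c * d) ≡ a * c * (b * d)
  lemma = ℕ.solve-∀

length-cartesianProductWith : ∀ {A B C : Set} (f : A → B → C) xs ys →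
  length (cartesianProductWith f xs ys) ≡ length xs * length ys
length-cartesianProductWith f []       ys = refl
length-cartesianProductWith f (x ∷ xs) ys =
  trans (List.length-++ (List.map (f x) ys))
        (cong₂ _+_ (List.length-map (f x) ys) (length-cartesianProductWith f xs ys))

∣p*n⇒∣n : ∀ {p d n} → Prime p → ¬ p ∣ d → d ∣ p * n → d ∣ n
∣p*n⇒∣n {p} {d} {n} pr p∤d (divides q e)
  with euclidsLemma q d pr (subst (p ∣_) e (m∣m*n n))
... | inj₂ p∣d = contradiction p∣d p∤d
... | inj₁ (divides r refl) =
  divides r (ℕ.*-cancelˡ-≡ n (r * d) p {{prime⇒nonZero pr}} (trans e (lemma r p d)))
  where
  lemma : ∀ r p d → r * p * d ≡ p * (r * d)
  lemma = ℕ.solve-∀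

divisor-of-prime-power-* : ∀ {p} → Prime p → ∀ a m {d} → d ∣ p ^ a * m →
  ∃ λ i → ∃ λ d′ → i ≤ a × d′ ∣ m × d ≡ p ^ i * d′
divisor-of-prime-power-* pr zero    m {d} d∣m =
  0 , d , z≤n , subst (d ∣_) (ℕ.*-identityˡ m) d∣m , sym (ℕ.*-identityˡ d)
divisor-of-prime-power-* {p} pr (suc a) m {d} d∣n with p ∣? d
... | yes (divides q refl)
  with i , d′ , i≤a , d′∣m , refl ← divisor-of-prime-power-* pr a m {q}
         (*-cancelʳ-∣ p {{prime⇒nonZero pr}} (subst (q * p ∣_)
            (trans (ℕ.*-assoc p (p ^ a) m) (ℕ.*-comm p _)) d∣n)) =
  suc i , d′ , s≤s i≤a , d′∣m , lemma (p ^ i) d′ p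
  where
  lemma : ∀ x d p → x * d * p ≡ p * x * d
  lemma = ℕ.solve-∀
... | no p∤d
  with i , d′ , i≤a , d′∣m , refl ← divisor-of-prime-power-* pr a m {d}
         (∣p*n⇒∣n pr p∤d (subst (d ∣_) (ℕ.*-assoc p (p ^ a) m) d∣n)) =
  i , d′ , ℕ.m≤n⇒m≤1+n i≤a , d′∣m , refl

remove-power : ∀ p → 1 < p → ∀ n → 0 < n → ∃ λ a → ∃ λ m → n ≡ p ^ a * m × ¬ p ∣ m
remove-power p 1<p = <-rec _ go
  where
  go : ∀ n → (∀ {m} → m < n → 0 < m → ∃ λ a → ∃ λ m′ → m ≡ p ^ a * m′ × ¬ p ∣ m′) →
       0 < n → ∃ λ a → ∃ λ m → n ≡ p ^ a * m × ¬ p ∣ m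
  go n rec 0<n with p ∣? n
  ... | no p∤n = 0 , n , sym (ℕ.*-identityˡ n) , p∤n
  ... | yes (divides zero refl) = contradiction 0<n λ ()
  ... | yes (divides q@(suc _) refl)
    with a , m , eq , p∤m ← rec (ℕ.m<m*n q p 1<p) z<s =
    suc a , m , trans (cong (_* p) eq) (lemma (p ^ a) m p) , p∤m
    where
    lemma : ∀ x m p → x * m * p ≡ p * x * m
    lemma = ℕ.solve-∀

1+n≤2^n : ∀ n → suc n ≤ 2 ^ n
1+n≤2^n zero    = ℕ.≤-refl
1+n≤2^n (suc n) = ℕ.+-mono-≤ (ℕ.m^n>0 2 n) (subst (suc n ≤_) (sym (ℕ.+-identityʳ _)) (1+n≤2^n n))

-- With `q = a / M` rounded down, `a + 1 ≤ M (q + 1) ≤ M 2^q`. This controls the `a + 1` divisors of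
-- `p^a` for small primes `p`.
power≤exponential : ∀ M .{{_ : NonZero M}} a → suc a ^ M ≤ M ^ M * 2 ^ a
power≤exponential M a = begin
  suc a ^ M             ≤⟨ ℕ.^-monoˡ-≤ M 1+a≤ ⟩
  (M * 2 ^ (a / M)) ^ M ≡⟨ trans (^-distribʳ-* M _ M) (cong (M ^ M *_) (ℕ.^-*-assoc 2 (a / M) M)) ⟩
  M ^ M * 2 ^ (a / M * M) ≤⟨ ℕ.*-monoʳ-≤ (M ^ M) (ℕ.^-monoʳ-≤ 2 (m/n*n≤m a M)) ⟩
  M ^ M * 2 ^ a ∎
  where
  open ℕ.≤-Reasoning
  1+a≤ : suc a ≤ M * 2 ^ (a / M)
  1+a≤ = begin
    suc a                   ≡⟨ cong suc (m≡m%n+[m/n]*n a M) ⟩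
    suc (a % M) + a / M * M ≤⟨ ℕ.+-monoˡ-≤ (a / M * M) (m%n<n a M) ⟩
    suc (a / M) * M         ≡⟨ ℕ.*-comm (suc (a / M)) M ⟩
    M * suc (a / M)         ≤⟨ ℕ.*-monoʳ-≤ M (1+n≤2^n (a / M)) ⟩
    M * 2 ^ (a / M)         ∎

-- The divisor bound `d(n) ≤ (K n)^(1/M)` without roots. The list has to contain all divisors but
-- may contain other numbers.
DivisorList : (M K n : ℕ) → Set
DivisorList M K n = Σ[ ds ∈ List ℕ ] (∀ d → d ∣ n → d ∈ ds) × length ds ^ M ≤ K * n

divisorList-prime-power-* : ∀ {M K K′ p} → Prime p → ∀ a m → suc a ^ M ≤ K′ * p ^ a →
                            DivisorList M K m → DivisorList M (K′ * K) (p ^ a * m)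
divisorList-prime-power-* {M} {K} {K′} {p} pr a m bound (ds , complete , short) =
  cartesianProductWith f (upTo (suc a)) ds , complete′ , short′
  where
  f : ℕ → ℕ → ℕ
  f i d = p ^ i * d
  complete′ : ∀ d → d ∣ p ^ a * m → d ∈ cartesianProductWith f (upTo (suc a)) ds
  complete′ d d∣n with i , d′ , i≤a , d′∣m , refl ← divisor-of-prime-power-* pr a m d∣n =
    ∈-cartesianProductWith⁺ f (∈-upTo⁺ (s≤s i≤a)) (complete d′ d′∣m)
  short′ : length (cartesianProductWith f (upTo (suc a)) ds) ^ M ≤ K′ * K * (p ^ a * m)
  short′ = begin
    length (cartesianProductWith f (upTo (suc a)) ds) ^ M
      ≡⟨ cong (_^ M) (trans (length-cartesianProductWith f (upTo (suc a)) ds)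
                            (cong (_* length ds) (List.length-upTo (suc a)))) ⟩
    (suc a * length ds) ^ M       ≡⟨ ^-distribʳ-* (suc a) (length ds) M ⟩
    suc a ^ M * length ds ^ M     ≤⟨ ℕ.*-mono-≤ bound short ⟩
    K′ * p ^ a * (K * m)          ≡⟨ lemma K′ (p ^ a) K m ⟩
    K′ * K * (p ^ a * m)          ∎
    where
    open ℕ.≤-Reasoning
    lemma : ∀ a b c d → a * b * (c * d) ≡ a * c * (b * d)
    lemma = ℕ.solve-∀

-- A prime `p ≥ 2^M` pays for the doubling of the list, so the constant stays `1`. Repeated primes
-- are treated as separate factors.
divisorList-large-primes : ∀ M {ps} → AllL.All Prime ps → AllL.All (2 ^ M ≤_) ps → DivisorList M 1 (product ps)
divisorList-large-primes M {[]} [] [] =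
  1 ∷ [] , (λ d d∣1 → here (∣1⇒≡1 d∣1)) , ℕ.≤-reflexive (ℕ.^-zeroˡ M)
divisorList-large-primes M {p ∷ ps} (pr ∷ prs) (2^M≤p ∷ larges) =
  subst (λ q → DivisorList M 1 (q * product ps)) (ℕ.*-identityʳ p)
    (divisorList-prime-power-* {M} {1} {1} pr 1 (product ps)
      (subst (2 ^ M ≤_) (sym (trans (ℕ.*-identityˡ _) (ℕ.*-identityʳ p))) 2^M≤p)
      (divisorList-large-primes M prs larges))

-- The candidates from `p` up to `2^M` are stripped off in turn; `gap` bounds how many are left, and
-- each costs a factor `M^M`. Roughness ensures that a candidate dividing `n` is prime.
divisorList-rough : ∀ M .{{_ : NonZero M}} gap p → 1 < p → 2 ^ M ≤ p + gap →
  ∀ n → 0 < n → p Rough n → DivisorList M ((M ^ M) ^ gap) n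
-- All prime factors are now at least `2^M`.
divisorList-rough M zero p 1<p 2^M≤p n 0<n rough =
  subst (DivisorList M 1) (sym isFactorisation)
    (divisorList-large-primes M factorsPrime (AllL.tabulate large))
  where
  open PrimeFactorisation (factorise n {{>-nonZero 0<n}})
  large : ∀ {q} → q ∈ factors → 2 ^ M ≤ q
  large {q} q∈ = ℕ.≮⇒≥ λ q<2^M → rough (hasNonTrivialDivisor
    {{prime⇒nonTrivial (AllL.lookup factorsPrime q∈)}}
    (ℕ.<-≤-trans q<2^M (subst (2 ^ M ≤_) (ℕ.+-identityʳ p) 2^M≤p))
    (subst (q ∣_) (sym isFactorisation) (∈⇒∣product q∈)))
divisorList-rough M (suc gap) p 1<p 2^M≤ n 0<n rough with remove-power p 1<p n 0<n
... | a , zero , refl , p∤m = contradiction 0<n (subst (λ z → ¬ (0 < z)) (sym (ℕ.*-zeroʳ (p ^ a))) λ ())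
... | a , m@(suc _) , refl , p∤m with ih ← divisorList-rough M gap (suc p) (ℕ.m<n⇒m<1+n 1<p)
    (subst (2 ^ M ≤_) (ℕ.+-suc p gap) 2^M≤) m z<s (∤⇒rough-suc p∤m (rough∧∣⇒rough rough (n∣m*n (p ^ a)))) | a
-- Here `p` does not divide `n`: the list stays and only the constant grows.
...   | zero = proj₁ ih , (λ d d∣n → proj₁ (proj₂ ih) d (subst (d ∣_) (ℕ.*-identityˡ m) d∣n)) ,
  ℕ.≤-trans (proj₂ (proj₂ ih)) (ℕ.*-mono-≤ (ℕ.m≤n*m _ (M ^ M) {{ℕ.m^n≢0 M M}}) (ℕ.m≤m+n m 0))
...   | a@(suc b) = divisorList-prime-power-* {M} {(M ^ M) ^ gap} {M ^ M}
  (rough∧∣⇒prime {{n>1⇒nonTrivial 1<p}} rough (∣m⇒∣m*n m (m∣m*n (p ^ b)))) a m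
  (ℕ.≤-trans (power≤exponential M a) (ℕ.*-monoʳ-≤ (M ^ M) (ℕ.^-monoˡ-≤ a 1<p))) ih

divisorConstant : ℕ → ℕ
divisorConstant M = (M ^ M) ^ (2 ^ M)

divisorList : ∀ M .{{_ : NonZero M}} n → 0 < n → DivisorList M (divisorConstant M) n
divisorList M n 0<n = divisorList-rough M (2 ^ M) 2 (s<s z<s) (ℕ.m≤n+m (2 ^ M) 2) n 0<n 2-rough

-- Counting

unique-⊆⇒length≤ : ∀ {xs ys : List A} → Unique xs → (∀ {x} → x ∈ xs → x ∈ ys) →
                   length xs ≤ length ys
unique-⊆⇒length≤ {xs = []}     []           xs⊆ys = z≤n
unique-⊆⇒length≤ {xs = x ∷ xs} (x∉xs ∷ xs!) xs⊆ys
  with ps , qs , refl ← ∈-∃++ (xs⊆ys (here refl)) =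
  subst (suc (length xs) ≤_) (sym (lengths ps))
    (s≤s (unique-⊆⇒length≤ xs! λ z∈xs → remove ps (AllL.lookup x∉xs z∈xs) (xs⊆ys (there z∈xs))))
  where
  lengths : ∀ ps → length (ps List.++ x ∷ qs) ≡ suc (length (ps List.++ qs))
  lengths []       = refl
  lengths (p ∷ ps) = cong suc (lengths ps)
  remove : ∀ ps {z} → x ≢ z → z ∈ ps List.++ x ∷ qs → z ∈ ps List.++ qs
  remove ps x≢z z∈ with ∈-++⁻ ps z∈
  ... | inj₁ z∈ps         = ∈-++⁺ˡ z∈ps
  ... | inj₂ (here refl)  = contradiction refl x≢z
  ... | inj₂ (there z∈qs) = ∈-++⁺ʳ ps z∈qs

∈-tuples⁺ : ∀ {xs : List A} (v : Vec A n) → (∀ i → lookup v i ∈ xs) → v ∈ tuples xs n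
∈-tuples⁺ []      v∈ = here refl
∈-tuples⁺ (a ∷ v) v∈ = ∈-cartesianProductWith⁺ _∷_ (v∈ zero) (∈-tuples⁺ v (v∈ ∘ suc))

∈-tuples⁻ : ∀ {xs : List A} {v : Vec A n} → v ∈ tuples xs n → ∀ i → lookup v i ∈ xs
∈-tuples⁻ {n = suc n} {xs} v∈ i with ∈-cartesianProductWith⁻ _∷_ xs (tuples xs n) v∈
∈-tuples⁻ {n = suc n} {xs} v∈ zero    | a , v , a∈ , v∈′ , refl = a∈
∈-tuples⁻ {n = suc n} {xs} v∈ (suc i) | a , v , a∈ , v∈′ , refl = ∈-tuples⁻ v∈′ i

tuples-unique : ∀ {xs : List A} → Unique xs → ∀ n → Unique (tuples xs n)
tuples-unique xs! zero    = [] ∷ []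
tuples-unique xs! (suc n) = Unique.cartesianProductWith⁺ _∷_ Vec.∷-injective xs! (tuples-unique xs! n)

length-tuples : ∀ (xs : List A) n → length (tuples xs n) ≡ length xs ^ n
length-tuples xs zero    = refl
length-tuples xs (suc n) =
  trans (length-cartesianProductWith _∷_ xs (tuples xs n)) (cong (length xs *_) (length-tuples xs n))

length-concatMap≤ : ∀ {A B : Set} (f : A → List B) {c} xs → (∀ x → length (f x) ≤ c) →
                    length (List.concatMap f xs) ≤ length xs * c
length-concatMap≤ f []       bound = z≤n
length-concatMap≤ f (x ∷ xs) bound =
  ℕ.≤-trans (ℕ.≤-reflexive (List.length-++ (f x)))
            (ℕ.+-mono-≤ (bound x) (length-concatMap≤ f xs bound))

∈-interval⁺ : ∀ {i} → ∣ i ∣ ≤ P → i ∈ interval P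
∈-interval⁺ {P} {i} ∣i∣≤P =
  subst (_∈ interval P) (trans (cong (λ w → w ℤ.- + P) (ℤ.0≤i⇒+∣i∣≡i (nonneg i ∣i∣≤P))) (lemma i (+ P)))
    (∈-map⁺ (λ j → + j ℤ.- + P) (∈-upTo⁺ (s≤s bound)))
  where
  lemma : ∀ i p → i ℤ.+ p ℤ.- p ≡ i
  lemma = ℤ.solve-∀
  bound : ∣ i ℤ.+ + P ∣ ≤ 2 * P
  bound = ℕ.≤-trans (ℤ.∣i+j∣≤∣i∣+∣j∣ i (+ P)) (ℕ.+-mono-≤ ∣i∣≤P (ℕ.m≤m+n P 0))
  nonneg : ∀ i → ∣ i ∣ ≤ P → 0ℤ ℤ.≤ i ℤ.+ + P
  nonneg (+ j)    ∣i∣≤P = ℤ.+≤+ z≤n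
  nonneg -[1+ j ] ∣i∣≤P rewrite ℤ.⊖-≥ ∣i∣≤P = ℤ.+≤+ z≤n

∈-interval⁻ : ∀ {i} → i ∈ interval P → ∣ i ∣ ≤ P
∈-interval⁻ {P} i∈ with j , j∈ , refl ← ∈-map⁻ (λ j → + j ℤ.- + P) i∈ | ℕ.≤-total j P
... | inj₁ j≤P rewrite ℤ.m-n≡m⊖n j P | ℤ.∣⊖∣-≤ j≤P = ℕ.m∸n≤m P j
... | inj₂ P≤j rewrite ℤ.m-n≡m⊖n j P | ℤ.⊖-≥ P≤j =
  ℕ.≤-trans (ℕ.∸-monoˡ-≤ P (ℕ.<⇒≤pred (∈-upTo⁻ j∈))) 
    (ℕ.≤-reflexive (trans (ℕ.m+n∸m≡n P (P + 0)) (ℕ.+-identityʳ P)))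

interval-unique : ∀ P → Unique (interval P)
interval-unique P =
  Unique.map⁺ (λ {i} {j} eq → ℤ.+-injective (∙-cancelʳ (ℤ.- + P) (+ i) (+ j) eq))
    (Unique.upTo⁺ (suc (2 * P)))

length-interval : ∀ P → length (interval P) ≡ suc (2 * P)
length-interval P = trans (List.length-map _ (upTo (suc (2 * P)))) (List.length-upTo (suc (2 * P)))

-- Solutions as members of a list

Bounded : ℕ → Vec ℤ n → Set
Bounded P x = ∀ i → ∣ lookup x i ∣ ≤ P

record Solution (P : ℕ) (h : Vec ℤ k) (x : Vec ℤ n) : Set where
  constructor solves
  field
    bounded : Bounded P x
    system  : OddPowerSystem h x

open Solution

solutions : ∀ n k P → Vec ℤ k → List (Vec ℤ n)
solutions n k P h = filter (oddPowerSystem? h) (tuples (interval P) n)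

∈-solutions⁺ : ∀ {h : Vec ℤ k} {x : Vec ℤ n} → Solution P h x → x ∈ solutions n k P h
∈-solutions⁺ {h = h} {x} (solves bound sys) =
  ∈-filter⁺ (oddPowerSystem? h) (∈-tuples⁺ x (∈-interval⁺ ∘ bound)) sys

∈-solutions⁻ : ∀ {h : Vec ℤ k} {x : Vec ℤ n} → x ∈ solutions n k P h → Solution P h x
∈-solutions⁻ {n = n} {P = P} {h} x∈
  with x∈tuples , sys ← ∈-filter⁻ (oddPowerSystem? h) {xs = tuples (interval P) n} x∈ =
  solves (∈-interval⁻ ∘ ∈-tuples⁻ x∈tuples) sys

U≤ : ∀ (h : Vec ℤ k) {ys : List (Vec ℤ n)} → (∀ {x} → x ∈ solutions n k P h → x ∈ ys) → U n k P h ≤ length ys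
U≤ {n = n} {P} h = unique-⊆⇒length≤ (Unique.filter⁺ (oddPowerSystem? h) (tuples-unique (interval-unique P) n))

≤U : ∀ (h : Vec ℤ k) {xs : List (Vec ℤ n)} → Unique xs →
     (∀ {x} → x ∈ xs → Solution P h x) →
     length xs ≤ U n k P h
≤U h xs! sols = unique-⊆⇒length≤ xs! (∈-solutions⁺ ∘ sols)

-- Finiteness of the list allows a sample solution to be fixed if there is one, without classical
-- logic.
search : ∀ {B C : A → Set} (xs : List A) → (∀ {x} → x ∈ xs → B x ⊎ C x) →
         ∃ B ⊎ (∀ {x} → x ∈ xs → C x)
search []       alt = inj₂ λ ()
search (x ∷ xs) alt with alt (here refl) | search xs (alt ∘ there)
... | inj₁ b | _      = inj₁ (x , b)
... | inj₂ c | inj₁ b = inj₁ b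
... | inj₂ c | inj₂ cs = inj₂ λ { (here refl) → c ; (there x∈) → cs x∈ }

-- Removing zeros and pairs v, - v from a solution

core? : (x : Vec ℤ n) → Dec (Core x)
core? x = Fin.all? λ i → Fin.all? λ j → ¬? (lookup x i ℤ.+ lookup x j ℤ.≟ 0ℤ)

¬core : (x : Vec ℤ n) → ¬ Core x → ∃ λ i → ∃ λ j → lookup x i ℤ.+ lookup x j ≡ 0ℤ
¬core {n} x ¬c
  with i , ¬ci ← Fin.¬∀⟶∃¬ n _ (λ i → Fin.all? λ j → ¬? (lookup x i ℤ.+ lookup x j ℤ.≟ 0ℤ)) ¬c
  with j , ¬cij ← Fin.¬∀⟶∃¬ n _ (λ j → ¬? (lookup x i ℤ.+ lookup x j ℤ.≟ 0ℤ)) ¬ci =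
  i , j , decidable-stable (lookup x i ℤ.+ lookup x j ℤ.≟ 0ℤ) ¬cij

lookup-removeAt : ∀ (Q : A → Set) (x : Vec A (suc n)) i → (∀ l → Q (lookup x l)) →
                  ∀ j → Q (lookup (removeAt x i) j)
lookup-removeAt Q (a ∷ x)     zero    q j       = q (suc j)
lookup-removeAt Q (a ∷ b ∷ x) (suc i) q zero    = q zero
lookup-removeAt Q (a ∷ b ∷ x) (suc i) q (suc j) = lookup-removeAt Q (b ∷ x) i (q ∘ suc) j

removeAt-lookup : ∀ (Q : A → Set) (x : Vec A (suc n)) i → Q (lookup x i) →
                  (∀ j → Q (lookup (removeAt x i) j)) → ∀ l → Q (lookup x l)
removeAt-lookup Q x i qi q l with i Fin.≟ l
... | yes refl = qi
... | no i≢l   = subst Q (Vec.removeAt-punchOut x i≢l) (q (punchOut i≢l))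

powerSum-removeAt : ∀ e (x : Vec ℤ (suc n)) i →
                    powerSum e x ≡ lookup x i ℤ.^ e ℤ.+ powerSum e (removeAt x i)
powerSum-removeAt e (a ∷ x)     zero    = refl
powerSum-removeAt e (a ∷ b ∷ x) (suc i) =
  trans (cong (λ w → a ℤ.^ e ℤ.+ w) (powerSum-removeAt e (b ∷ x) i))
        (lemma (a ℤ.^ e) (lookup (b ∷ x) i ℤ.^ e) (powerSum e (removeAt (b ∷ x) i)))
  where
  lemma : ∀ u v w → u ℤ.+ (v ℤ.+ w) ≡ v ℤ.+ (u ℤ.+ w)
  lemma = ℤ.solve-∀

removeAt-zero : ∀ {h : Vec ℤ k} (x : Vec ℤ (suc n)) i → lookup x i ≡ 0ℤ →
                Solution P h x → Solution P h (removeAt x i)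
removeAt-zero {P = P} x i x≡0 (solves bound sys) = solves (lookup-removeAt (λ v → ∣ v ∣ ≤ P) x i bound) λ j →
  trans (sym (trans (powerSum-removeAt (suc (2 * toℕ j)) x i)
    (trans (cong (λ v → v ℤ.^ suc (2 * toℕ j) ℤ.+ powerSum (suc (2 * toℕ j)) (removeAt x i)) x≡0)
           (ℤ.+-identityˡ _)))) (sys j)

removePair : (x : Vec ℤ (2 + n)) → ∀ {i j} → i ≢ j → Vec ℤ n
removePair x {i} i≢j = removeAt (removeAt x i) (punchOut i≢j)

opposite : ∀ {a b} → a ℤ.+ b ≡ 0ℤ → b ≡ ℤ.- a
opposite {a} {b} eq = trans (lemma a b) (trans (cong (λ w → w ℤ.- a) eq) (ℤ.+-identityˡ (ℤ.- a)))
  where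
  lemma : ∀ a b → b ≡ (a ℤ.+ b) ℤ.- a
  lemma = ℤ.solve-∀

removePair-solution : ∀ {h : Vec ℤ k} (x : Vec ℤ (2 + n)) {i j} (i≢j : i ≢ j) →
  lookup x i ℤ.+ lookup x j ≡ 0ℤ → Solution P h x → Solution P h (removePair x i≢j)
removePair-solution {P = P} x {i} {j} i≢j cancel (solves bound sys) = solves
  (lookup-removeAt B (removeAt x i) (punchOut i≢j) (lookup-removeAt B x i bound)) λ l →
  trans (sym (sums (toℕ l))) (sys l)
  where
  B : ℤ → Set
  B v = ∣ v ∣ ≤ P
  x′ = removePair x i≢j
  sums : ∀ l → powerSum (suc (2 * l)) x ≡ powerSum (suc (2 * l)) x′
  sums l = begin
    powerSum e x
      ≡⟨ trans (powerSum-removeAt e x i)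
         (cong (λ w → lookup x i ℤ.^ e ℤ.+ w) (powerSum-removeAt e (removeAt x i) (punchOut i≢j))) ⟩
    lookup x i ℤ.^ e ℤ.+ (lookup (removeAt x i) (punchOut i≢j) ℤ.^ e ℤ.+ powerSum e x′)
      ≡⟨ cong (λ w → lookup x i ℤ.^ e ℤ.+ (w ℤ.^ e ℤ.+ powerSum e x′))
           (trans (Vec.removeAt-punchOut x i≢j) (opposite {lookup x i} cancel)) ⟩
    lookup x i ℤ.^ e ℤ.+ ((ℤ.- lookup x i) ℤ.^ e ℤ.+ powerSum e x′)
      ≡⟨ cong (λ w → lookup x i ℤ.^ e ℤ.+ (w ℤ.+ powerSum e x′)) (odd-neg (lookup x i) l) ⟩
    lookup x i ℤ.^ e ℤ.+ (ℤ.- (lookup x i ℤ.^ e) ℤ.+ powerSum e x′)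
      ≡⟨ lemma (lookup x i ℤ.^ e) (powerSum e x′) ⟩
    powerSum e x′ ∎
    where
    open ≡-Reasoning
    e = suc (2 * l)
    lemma : ∀ a b → a ℤ.+ (ℤ.- a ℤ.+ b) ≡ b
    lemma = ℤ.solve-∀

-- Records only where a value comes from, not its position or multiplicity: a short list of possible
-- entries already bounds the number of tuples.
data Entry (c : Vec ℤ m) (vs : Vec ℤ n) : ℤ → Set where
  zeroᵉ : Entry c vs 0ℤ
  coreᵉ : ∀ i → Entry c vs (lookup c i)
  posᵉ  : ∀ i → Entry c vs (lookup vs i)
  negᵉ  : ∀ i → Entry c vs (ℤ.- lookup vs i)

entry-∷ : ∀ {c : Vec ℤ m} {vs : Vec ℤ n} {v u} → Entry c vs u → Entry c (v ∷ vs) u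
entry-∷ zeroᵉ     = zeroᵉ
entry-∷ (coreᵉ i) = coreᵉ i
entry-∷ (posᵉ i)  = posᵉ (suc i)
entry-∷ (negᵉ i)  = negᵉ (suc i)

-- A solution that represents h after the removal of f pairs.
Representation : ℕ → Vec ℤ k → (f n : ℕ) → Set
Representation P h f n = Σ[ m ∈ ℕ ] n ≡ 2 * f + m × Σ[ y ∈ Vec ℤ m ] Solution P h y

-- With `n = k + 1` the strict inequality leaves at most `k` entries, so that two such cores have at
-- most `2 k` together.
ShortCore : Vec ℤ k → ℕ → Set
ShortCore h n = Σ[ m ∈ ℕ ] m < n × Σ[ c ∈ Vec ℤ m ] Core c × OddPowerSystem h c

-- x consists of zeros, the core, and pairs vⱼ, - vⱼ for at most f values vⱼ.
Decomposed : ℕ → Vec ℤ k → ℕ → Vec ℤ n → Set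
Decomposed {n = n} P h f x =
  Σ[ (_ , _ , c , _) ∈ ShortCore h n ] Σ[ vs ∈ Vec ℤ f ] Bounded P vs × (∀ i → Entry c vs (lookup x i))

-- `f` is a budget of pairs: either it is exceeded, or a short core and `f` values account for all
-- entries.
Reduced : ℕ → Vec ℤ k → ℕ → Vec ℤ n → Set
Reduced {n = n} P h f x = Representation P h (suc f) n ⊎ Decomposed P h f x

core⇒decomposed : ∀ {h : Vec ℤ k} f {x : Vec ℤ n} (c : Vec ℤ m) → m < n → Core c → Solution P h c →
                  (vs : Vec ℤ f) → Bounded P vs → (∀ i → Entry c vs (lookup x i)) → Decomposed P h f x
core⇒decomposed {m = m} f c m<n core (solves _ sys) vs bound es = (m , m<n , c , core , sys) , vs , bound , es

zeros-bounded : ∀ f → Bounded P (replicate f 0ℤ)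
zeros-bounded f j rewrite Vec.lookup-replicate j 0ℤ = z≤n

reinsert-zero : ∀ {h : Vec ℤ k} f (x : Vec ℤ (suc n)) i → lookup x i ≡ 0ℤ →
  Solution P h (removeAt x i) → Reduced P h f (removeAt x i) ⊎ Core (removeAt x i) → Reduced P h f x
reinsert-zero f x i eq sol (inj₁ (inj₁ (m , refl , y , solves bound sys))) =
  -- The removed zero is put back into the remainder, so that the length is right.
  inj₁ (suc m , sym (ℕ.+-suc (2 * suc f) m) , 0ℤ ∷ y , solves
    (λ { zero → z≤n ; (suc i) → bound i }) λ j → trans (ℤ.+-identityˡ _) (sys j))
reinsert-zero f x i eq sol (inj₁ (inj₂ ((m , m<n , c@(core , _)) , vs , bound , es))) =
  inj₂ ((m , ℕ.m<n⇒m<1+n m<n , c) , vs , bound ,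
    removeAt-lookup (Entry core vs) x i (subst (Entry _ vs) (sym eq) zeroᵉ) es)
reinsert-zero f x i eq sol (inj₂ c) =
  -- No pair has been removed, so the `f` slots for pair values receive zeros by default.
  inj₂ (core⇒decomposed f {x} (removeAt x i) ℕ.≤-refl c sol (replicate f 0ℤ) (zeros-bounded f)
    (removeAt-lookup (Entry (removeAt x i) (replicate f 0ℤ)) x i (subst (Entry _ _) (sym eq) zeroᵉ) coreᵉ))

reinsert-pair : ∀ {h : Vec ℤ k} f (x : Vec ℤ (2 + n)) {i j} (i≢j : i ≢ j) →
  lookup x i ℤ.+ lookup x j ≡ 0ℤ → Bounded P x → Solution P h (removePair x i≢j) →
  Reduced P h f (removePair x i≢j) ⊎ Core (removePair x i≢j) → Reduced P h (suc f) x
reinsert-pair {n = n} f x {i} {j} i≢j eq bound sol red = reinsert red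
  where
  entries : ∀ {m f} {c : Vec ℤ m} {vs : Vec ℤ f} → (∀ l → Entry c vs (lookup (removePair x i≢j) l)) →
            ∀ l → Entry c (lookup x i ∷ vs) (lookup x l)
  entries {c = c} {vs} es = removeAt-lookup (Entry c (lookup x i ∷ vs)) x i (posᵉ zero)
    (removeAt-lookup (Entry c (lookup x i ∷ vs)) (removeAt x i) (punchOut i≢j)
    (subst (Entry _ _)
      (sym (trans (Vec.removeAt-punchOut x i≢j) (opposite {lookup x i} eq))) (negᵉ zero)) (entry-∷ ∘ es))
  bounded-∷ : ∀ {f} {vs : Vec ℤ f} → Bounded _ vs → Bounded _ (lookup x i ∷ vs)
  bounded-∷ b zero    = bound i
  bounded-∷ b (suc l) = b l
  reinsert : _ → _
  reinsert (inj₁ (inj₁ (m , refl , y))) = inj₁ (m , lemma f m , y)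
    where
    lemma : ∀ f m → 2 + (2 * suc f + m) ≡ 2 * suc (suc f) + m
    lemma = ℕ.solve-∀
  reinsert (inj₁ (inj₂ ((m , m<n , c) , vs , b , es))) =
    inj₂ ((m , ℕ.m<n⇒m<1+n (ℕ.m<n⇒m<1+n m<n) , c) , lookup x i ∷ vs , bounded-∷ b , entries es)
  reinsert (inj₂ c) = inj₂ (core⇒decomposed (suc f) {x} (removePair x i≢j) (ℕ.m<n⇒m<1+n ℕ.≤-refl) c sol
    (lookup x i ∷ replicate f 0ℤ) (bounded-∷ (zeros-bounded f)) (entries coreᵉ))

double-zero : ∀ {v} → v ℤ.+ v ≡ 0ℤ → v ≡ 0ℤ
double-zero {+ zero} eq = refl

-- Zeros and pairs are removed while there are any, each pair costing one unit of `f`. `Core x` is a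
-- separate outcome because a core of full length is not short.
classify : ∀ {h : Vec ℤ k} f (x : Vec ℤ n) → Solution P h x → Reduced P h f x ⊎ Core x
classify {n = zero} f x sol = inj₂ λ ()
classify {n = suc n} f x sol with core? x
... | yes c = inj₂ c
... | no ¬c with ¬core x ¬c
...   | i , j , eq with i Fin.≟ j
...     | yes refl = inj₁ (reinsert-zero f x i (double-zero eq) sol′ (classify f (removeAt x i) sol′))
  where sol′ = removeAt-zero x i (double-zero eq) sol
classify {n = 1} f x sol | no ¬c | zero , zero , eq | no i≢j = contradiction refl i≢j
-- The budget is spent, so this pair is the one in excess.
classify {n = suc (suc n)} zero x sol | no ¬c | i , j , eq | no i≢j =
  inj₁ (inj₁ (n , refl , removePair x i≢j , removePair-solution x i≢j eq sol))
classify {n = suc (suc n)} (suc f) x sol | no ¬c | i , j , eq | no i≢j =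
  inj₁ (reinsert-pair f x i≢j eq (bounded sol) sol′ (classify f (removePair x i≢j) sol′))
  where sol′ = removePair-solution x i≢j eq sol

-- Solutions that contain a zero or a pair v, - v

entryList : Vec ℤ m → Vec ℤ n → List ℤ
entryList c vs = 0ℤ ∷ tabulate (lookup c) List.++ tabulate (lookup vs) List.++ tabulate (λ i → ℤ.- lookup vs i)

entry⇒∈ : ∀ {c : Vec ℤ m} {vs : Vec ℤ n} {v} → Entry c vs v → v ∈ entryList c vs
entry⇒∈ zeroᵉ = here refl
entry⇒∈ {c = c} (coreᵉ i) = there (∈-++⁺ˡ (∈-tabulate⁺ {f = lookup c} i))
entry⇒∈ {c = c} {vs} (posᵉ i) = there (∈-++⁺ʳ (tabulate (lookup c)) (∈-++⁺ˡ (∈-tabulate⁺ {f = lookup vs} i)))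
entry⇒∈ {c = c} {vs} (negᵉ i) =
  there (∈-++⁺ʳ (tabulate (lookup c)) (∈-++⁺ʳ (tabulate (lookup vs)) (∈-tabulate⁺ {f = λ i → ℤ.- lookup vs i} i)))

length-entryList : ∀ (c : Vec ℤ m) (vs : Vec ℤ n) → length (entryList c vs) ≡ suc (m + (n + n))
length-entryList c vs = cong suc (trans (List.length-++ (tabulate (lookup c)))
  (cong₂ _+_ (List.length-tabulate (lookup c)) (trans (List.length-++ (tabulate (lookup vs)))
    (cong₂ _+_ (List.length-tabulate (lookup vs)) (List.length-tabulate (λ i → ℤ.- lookup vs i))))))

entry-core : ∀ {c : Vec ℤ m} {c′ : Vec ℤ n} {f} {vs : Vec ℤ f} → (∀ i → ∃ λ j → lookup c′ j ≡ lookup c i) →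
             ∀ {v} → Entry c vs v → Entry c′ vs v
entry-core c⊆c′ zeroᵉ = zeroᵉ
entry-core c⊆c′ (coreᵉ i) with j , eq ← c⊆c′ i = subst (Entry _ _) eq (coreᵉ j)
entry-core c⊆c′ (posᵉ i) = posᵉ i
entry-core c⊆c′ (negᵉ i) = negᵉ i

decomposedList : ℕ → (f n : ℕ) → Vec ℤ m → List (Vec ℤ n)
decomposedList P f n c = concatMap (λ vs → tuples (entryList c vs) n) (tuples (interval P) f)

-- Only the choice of the `f` pair values depends on `P`; the entries then come from a list of
-- length independent of `P`.
length-decomposedList : ∀ P f n (c : Vec ℤ m) →
  length (decomposedList P f n c) ≤ suc (2 * P) ^ f * suc (m + (f + f)) ^ n
length-decomposedList {m} P f n c = ℕ.≤-trans
  (length-concatMap≤ _ (tuples (interval P) f) λ vs → ℕ.≤-reflexive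
    (trans (length-tuples (entryList c vs) n) (cong (_^ n) (length-entryList c vs))))
  (ℕ.≤-reflexive (cong (_* suc (m + (f + f)) ^ n)
    (trans (length-tuples (interval P) f) (cong (_^ f) (length-interval P)))))

-- Any one short core determines the entries of all others.
∈-decomposedList : ∀ {h : Vec ℤ k} {f} {x : Vec ℤ (suc k)} ((m , _ , c , _) : ShortCore h (suc k)) →
                   Decomposed P h f x → x ∈ decomposedList P f (suc k) c
∈-decomposedList {k = k} {h = h} {x = x} (m , s≤s m≤k , c , _ , sys)
  ((m′ , s≤s m′≤k , c′ , core′ , sys′) , vs , bound , es) =
  ∈-concatMap⁺ (λ vs → tuples (entryList c vs) (suc k)) (lose (∈-tuples⁺ vs (∈-interval⁺ ∘ bound))
    (∈-tuples⁺ x λ i → entry⇒∈ (entry-core {c = c′} {c} agree (es i))))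
  where
  agree : ∀ i → ∃ λ j → lookup c j ≡ lookup c′ i
  agree = short-cores-agree {h = h} c′ c (ℕ.+-mono-≤ m′≤k (ℕ.≤-trans m≤k (ℕ.m≤m+n k 0))) sys′ sys core′

-- Solutions that are cores

-- Only the values at doubles matter; the rounding elsewhere is arbitrary.
half : ℤ → ℤ
half i = ℤ.sign i ℤ.◃ ⌊ ∣ i ∣ /2⌋

half-double : ∀ i → half (i ℤ.+ i) ≡ i
half-double (+ n)    = trans (cong (λ w → ℤ.sign (+ (n + n)) ℤ.◃ w) (sym (ℕ.n≡⌊n+n/2⌋ n))) (ℤ.+◃n≡+n n)
half-double -[1+ n ] = cong -[1+_] (sym (ℕ.n≡⌊n+n/2⌋ n))

signed : List ℕ → List ℤ
signed ds = List.map +_ ds List.++ List.map (λ d → ℤ.- + d) ds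

∈-signed : ∀ {ds} i → ∣ i ∣ ∈ ds → i ∈ signed ds
∈-signed      (+ n)    n∈ = ∈-++⁺ˡ (∈-map⁺ +_ n∈)
∈-signed {ds} -[1+ n ] n∈ = ∈-++⁺ʳ (List.map +_ ds) (∈-map⁺ (λ d → ℤ.- + d) n∈)

length-signed : ∀ ds → length (signed ds) ≡ 2 * length ds
length-signed ds = trans (List.length-++ (List.map +_ ds)) (cong₂ _+_ (List.length-map +_ ds)
  (trans (List.length-map _ ds) (sym (ℕ.+-identityʳ _))))

halfCombinations : List ℤ → List ℤ
halfCombinations ss = cartesianProductWith (λ u w → half (u ℤ.+ w)) ss (cartesianProductWith ℤ._-_ ss ss)

length-halfCombinations : ∀ ss → length (halfCombinations ss) ≡ length ss * (length ss * length ss)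
length-halfCombinations ss = trans (length-cartesianProductWith _ ss _)
  (cong (length ss *_) (length-cartesianProductWith ℤ._-_ ss ss))

-- Recovering an entry from pair sums takes three positions; `2 ≤ k` provides them among `k + 1`.
two-others : ∀ (i : Fin (3 + n)) → ∃ λ j → ∃ λ l → i ≢ j × i ≢ l × j ≢ l
two-others zero          = suc zero , suc (suc zero) , (λ ()) , (λ ()) , λ ()
two-others (suc zero)    = zero , suc (suc zero) , (λ ()) , (λ ()) , λ ()
two-others (suc (suc i)) = zero , suc zero , (λ ()) , (λ ()) , λ ()

-- 2 xᵢ = (xᵢ + xⱼ) + ((xᵢ + xₗ) - (xⱼ + xₗ)).
entries-from-pair-sums : ∀ (x : Vec ℤ (3 + n)) ss → (∀ i j → i ≢ j → lookup x i ℤ.+ lookup x j ∈ ss) →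
                         ∀ i → lookup x i ∈ halfCombinations ss
entries-from-pair-sums x ss sums i with j , l , i≢j , i≢l , j≢l ← two-others i =
  subst (_∈ halfCombinations ss)
    (trans (cong half (lemma (lookup x i) (lookup x j) (lookup x l))) (half-double (lookup x i)))
    (∈-cartesianProductWith⁺ (λ u w → half (u ℤ.+ w)) (sums i j i≢j)
      (∈-cartesianProductWith⁺ ℤ._-_ (sums i l i≢l) (sums j l j≢l)))
  where
  lemma : ∀ a b c → (a ℤ.+ b) ℤ.+ ((a ℤ.+ c) ℤ.- (b ℤ.+ c)) ≡ a ℤ.+ a
  lemma = ℤ.solve-∀

-- The entries of a fixed core `y` serve the case `e = 0`, the combinations of divisors the case
-- `e ≠ 0`.
coreEntries : Vec ℤ n → List ℕ → List ℤ
coreEntries y ds = tabulate (lookup y) List.++ halfCombinations (signed ds)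

length-coreEntries : ∀ (y : Vec ℤ n) ds →
  length (coreEntries y ds) ≡ n + 2 * length ds * (2 * length ds * (2 * length ds))
length-coreEntries y ds = trans (List.length-++ (tabulate (lookup y)))
  (cong₂ _+_ (List.length-tabulate (lookup y))
    (trans (length-halfCombinations (signed ds)) (cong (λ l → l * (l * l)) (length-signed ds))))

almostEven⇒core-entries : ∀ (x y : Vec ℤ (3 + n)) e → AlmostEven x y e → Core x → Core y →
  ∀ {ds} → (∀ d → d ∣ ∣ pairSums y ∣ → d ∈ ds) → Dec (e ≡ 0ℤ) → ∀ i → lookup x i ∈ coreEntries y ds
almostEven⇒core-entries x y e ae cx cy complete (yes refl) i
  with j , eq ← even-cores-agree x y ae cx i =
  ∈-++⁺ˡ (subst (_∈ tabulate (lookup y)) eq (∈-tabulate⁺ {f = lookup y} j))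
almostEven⇒core-entries x y e ae cx cy {ds} complete (no e≢0) i =
  ∈-++⁺ʳ (tabulate (lookup y)) (entries-from-pair-sums x (signed ds) sums i)
  where
  sums : ∀ i j → i ≢ j → lookup x i ℤ.+ lookup x j ∈ signed ds
  sums i j i≢j = ∈-signed (lookup x i ℤ.+ lookup x j) (complete ∣ lookup x i ℤ.+ lookup x j ∣
    (subst (∣ lookup x i ℤ.+ lookup x j ∣ ∣_) (pairSums-unique x y {e} ae e≢0 cx cy) (∣pairSums x i j i≢j)))

core-entries : 2 ≤ k → ∀ {h : Vec ℤ k} (x y : Vec ℤ (suc k)) → OddPowerSystem h x → OddPowerSystem h y →
  Core x → Core y → ∀ {ds} → (∀ d → d ∣ ∣ pairSums y ∣ → d ∈ ds) → ∀ i → lookup x i ∈ coreEntries y ds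
core-entries (s≤s (s≤s z≤n)) {h} x y sx sy cx cy complete =
  almostEven⇒core-entries x y (proj₁ ae) (proj₂ ae) cx cy complete (proj₁ ae ℤ.≟ 0ℤ)
  where ae = almostEven {h = h} x y sx sy

pairSums-nonzero : ∀ (x : Vec ℤ n) → Core x → pairSums x ≢ 0ℤ
pairSums-nonzero x core eq
  with i , p ← Π-zero⁻ _ x (trans (pairSums-square x)
         (trans (cong (λ w → Π (λ a → a ℤ.+ a) x ℤ.* (w ℤ.* pairSums x)) eq) (ℤ.*-zeroʳ (Π (λ a → a ℤ.+ a) x))))
  with j , q ← Π-zero⁻ _ x p = core i j q

-- Each pair sum is at most `2 P` in absolute value, and `n * n` is a generous bound for their
-- number.
pairSums-bound : 1 ≤ P → ∀ (x : Vec ℤ n) → Bounded P x → ∣ pairSums x ∣ ≤ (2 * P) ^ (n * n)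
pairSums-bound 1≤P [] bound = ℕ.≤-refl
pairSums-bound {P} {suc n} 1≤P (a ∷ x) bound = begin
  ∣ Π (λ b → a ℤ.+ b) x ℤ.* pairSums x ∣       ≡⟨ ℤ.abs-* (Π (λ b → a ℤ.+ b) x) (pairSums x) ⟩
  ∣ Π (λ b → a ℤ.+ b) x ∣ * ∣ pairSums x ∣     ≤⟨ ℕ.*-mono-≤ (factors x (bound ∘ suc))
                  (pairSums-bound 1≤P x (bound ∘ suc)) ⟩
  (2 * P) ^ n * (2 * P) ^ (n * n)              ≡⟨ ℕ.^-distribˡ-+-* (2 * P) n (n * n) ⟨
  (2 * P) ^ (n + n * n)                        ≤⟨ ℕ.^-monoʳ-≤ (2 * P) {{2P≢0}}
                  (ℕ.≤-trans (ℕ.m≤n+m _ (suc n)) (ℕ.≤-reflexive (lemma n))) ⟩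
  (2 * P) ^ (suc n * suc n)                    ∎
  where
  open ℕ.≤-Reasoning
  2P≢0 : NonZero (2 * P)
  2P≢0 = >-nonZero (ℕ.≤-trans 1≤P (ℕ.m≤m+n P _))
  lemma : ∀ n → suc n + (n + n * n) ≡ suc n * suc n
  lemma = ℕ.solve-∀
  factors : ∀ {m} (x : Vec ℤ m) → Bounded P x → ∣ Π (λ b → a ℤ.+ b) x ∣ ≤ (2 * P) ^ m
  factors []      b = ℕ.≤-refl
  factors (z ∷ x) b = ℕ.≤-trans (ℕ.≤-reflexive (ℤ.abs-* (a ℤ.+ z) _))
    (ℕ.*-mono-≤ (ℕ.≤-trans (ℤ.∣i+j∣≤∣i∣+∣j∣ a z) (ℕ.+-mono-≤ (bound zero) (ℕ.≤-trans (b zero) (ℕ.m≤m+n P 0))))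
                (factors x (b ∘ suc)))

-- The two alternatives for a given system

-- ℓ bounds the number of divisors of some nonzero number below (2 P)^(n²).
coreBound : (n ℓ : ℕ) → ℕ
coreBound n ℓ = (n + 2 * ℓ * (2 * ℓ * (2 * ℓ))) ^ n

decomposedBound : (n r P : ℕ) → ℕ
decomposedBound n r P = suc (2 * P) ^ r * suc (n + (r + r)) ^ n

-- If one solution is decomposed, its core determines the possible entries of all the others; if
-- none is, the empty list suffices.
cover-decomposed : ∀ {h : Vec ℤ k} r → let n = suc k in
  (∀ {x} → x ∈ solutions n k P h → Decomposed P h r x ⊎ Core x) →
  Σ[ ys ∈ List (Vec ℤ n) ] length ys ≤ decomposedBound n r P ×
    (∀ {x} → x ∈ solutions n k P h → x ∈ ys ⊎ Core x)
cover-decomposed {k} {P} {h} r alt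
  with search (solutions (suc k) k P h) (λ x∈ → [ inj₁ ∘ proj₁ , inj₂ ]′ (alt x∈))
... | inj₂ cores = [] , z≤n , inj₂ ∘ cores
... | inj₁ (_ , short@(m , m<n , c , _)) =
  decomposedList P r (suc k) c ,
  ℕ.≤-trans (length-decomposedList P r (suc k) c)
    (ℕ.*-monoʳ-≤ (suc (2 * P) ^ r) (ℕ.^-monoˡ-≤ (suc k) (s≤s (ℕ.+-monoˡ-≤ (r + r) (ℕ.<⇒≤ m<n))))) ,
  λ x∈ → [ inj₁ ∘ ∈-decomposedList {h = h} short , inj₂ ]′ (alt x∈)

core-divisors : ∀ M .{{_ : NonZero M}} → 1 ≤ P → ∀ (y : Vec ℤ n) → Core y → Bounded P y →
  Σ[ ds ∈ List ℕ ] (∀ d → d ∣ ∣ pairSums y ∣ → d ∈ ds) ×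
    1 ≤ length ds × length ds ^ M ≤ divisorConstant M * (2 * P) ^ (n * n)
core-divisors M 1≤P y core bound
  with ds , complete , short ← divisorList M ∣ pairSums y ∣
         (ℕ.n≢0⇒n>0 (pairSums-nonzero y core ∘ ℤ.∣i∣≡0⇒i≡0)) =
  ds , complete , nonempty (complete 1 (1∣ _)) ,
  ℕ.≤-trans short (ℕ.*-monoʳ-≤ (divisorConstant M) (pairSums-bound 1≤P y bound))
  where
  nonempty : ∀ {d} {ds : List ℕ} → d ∈ ds → 1 ≤ length ds
  nonempty (here _)  = s≤s z≤n
  nonempty (there _) = s≤s z≤n

1^-bound : ∀ M .{{_ : NonZero M}} n → 1 ≤ P → 1 ^ M ≤ divisorConstant M * (2 * P) ^ n
1^-bound {P} M n 1≤P = ℕ.≤-trans (ℕ.≤-reflexive (ℕ.^-zeroˡ M)) (ℕ.*-mono-≤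
  (ℕ.m^n>0 (M ^ M) {{ℕ.m^n≢0 M M}} (2 ^ M))
  (ℕ.m^n>0 (2 * P) {{>-nonZero (ℕ.≤-trans 1≤P (ℕ.m≤m+n P _))}} n))

length-core-tuples : ∀ (y : Vec ℤ n) ds → length (tuples (coreEntries y ds) n) ≤ coreBound n (length ds)
length-core-tuples {n} y ds = ℕ.≤-reflexive
  (trans (length-tuples (coreEntries y ds) n) (cong (_^ n) (length-coreEntries y ds)))

-- One core `y` is fixed, if there is any. The divisors of its product of pair sums, together with
-- its own entries, then confine the entries of every core.
cover-cores : 2 ≤ k → ∀ {h : Vec ℤ k} M .{{_ : NonZero M}} → let n = suc k in 1 ≤ P →
  Σ[ ℓ ∈ ℕ ] 1 ≤ ℓ × ℓ ^ M ≤ divisorConstant M * (2 * P) ^ (n * n) ×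
  Σ[ ys ∈ List (Vec ℤ n) ] length ys ≤ coreBound n ℓ ×
    (∀ {x} → x ∈ solutions n k P h → Core x → x ∈ ys)
cover-cores {k} {P} 2≤k {h} M 1≤P
  with search {B = λ x → Core x × Solution P h x} (solutions (suc k) k P h) (λ {x} x∈ → case-core x∈ (core? x))
  where
  case-core : ∀ {x} → x ∈ solutions (suc k) k P h → Dec (Core x) → (Core x × Solution P h x) ⊎ ¬ Core x
  case-core x∈ (yes c) = inj₁ (c , ∈-solutions⁻ {P = P} {h} x∈)
  case-core x∈ (no ¬c) = inj₂ ¬c
-- Without cores, `ℓ = 1` is a default that meets the bounds.
... | inj₂ none = 1 , ℕ.≤-refl , 1^-bound M (suc k * suc k) 1≤P , [] , z≤n , λ x∈ c → contradiction c (none x∈)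
... | inj₁ (y , cy , soly)
  with ds , complete , nonempty , short ← core-divisors M 1≤P y cy (bounded soly) =
  length ds , nonempty , short , tuples (coreEntries y ds) (suc k) , length-core-tuples y ds ,
  λ {x} x∈ cx → ∈-tuples⁺ x
    (core-entries 2≤k {h} x y (system (∈-solutions⁻ {P = P} {h} x∈)) (system soly) cx cy complete)

alternatives : ∀ {A B C : Set} → (A ⊎ B) ⊎ C → A ⊎ (B ⊎ C)
alternatives (inj₁ (inj₁ a)) = inj₁ a
alternatives (inj₁ (inj₂ b)) = inj₂ (inj₁ b)
alternatives (inj₂ c)        = inj₂ (inj₂ c)

representation-or-bound : 2 ≤ k → ∀ (h : Vec ℤ k) r M .{{_ : NonZero M}} → let n = suc k in 1 ≤ P →
  Representation P h (suc r) n ⊎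
  (Σ[ ℓ ∈ ℕ ] 1 ≤ ℓ × ℓ ^ M ≤ divisorConstant M * (2 * P) ^ (n * n) ×
     U n k P h ≤ decomposedBound n r P + coreBound n ℓ)
representation-or-bound {k} {P} 2≤k h r M 1≤P
  with search (solutions (suc k) k P h) (λ {x} x∈ → alternatives (classify r x (∈-solutions⁻ {P = P} {h} x∈)))
... | inj₁ (_ , rep) = inj₁ rep
... | inj₂ alt
  with ys , ys-short , in-ys ← cover-decomposed {h = h} r alt
  with ℓ , 1≤ℓ , ℓ-bound , zs , zs-short , in-zs ← cover-cores 2≤k {h} M 1≤P =
  inj₂ (ℓ , 1≤ℓ , ℓ-bound , ℕ.≤-trans
    (U≤ {P = P} h {ys List.++ zs} λ x∈ → [ ∈-++⁺ˡ , ∈-++⁺ʳ ys ∘ in-zs x∈ ]′ (in-ys x∈))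
    (ℕ.≤-trans (ℕ.≤-reflexive (List.length-++ ys)) (ℕ.+-mono-≤ ys-short zs-short)))

-- The upper bound

^-cancelˡ-≤ : ∀ n {a b} .{{_ : NonZero n}} → a ^ n ≤ b ^ n → a ≤ b
^-cancelˡ-≤ n a^n≤b^n = ℕ.≮⇒≥ λ b<a → ℕ.<⇒≱ (ℕ.^-monoˡ-< n b<a) a^n≤b^n

n≤n^m : ∀ n m .{{_ : NonZero m}} → n ≤ n ^ m
n≤n^m zero    m       = z≤n
n≤n^m (suc n) (suc m) = ℕ.m≤m*n (suc n) (suc n ^ m) {{ℕ.m^n≢0 (suc n) m}}

rootDivisorConstant : (n B : ℕ) → ℕ
rootDivisorConstant n B = divisorConstant (3 * n * B * (n * n)) * 2

-- The divisor bound is used with `M = 3 n B n^2`: the factor `n^2` serves to reduce `(2 P)^(n^2)`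
-- to `2 P`, and what remains is the `B`-th power of the `ℓ^(3 n)` in `count-bound`.
divisor-count-root : ∀ n B ℓ .{{_ : NonZero n}} →
  ℓ ^ (3 * n * B * (n * n)) ≤ divisorConstant (3 * n * B * (n * n)) * (2 * P) ^ (n * n) →
                     (ℓ ^ (3 * n)) ^ B ≤ rootDivisorConstant n B * P
divisor-count-root {P} n B ℓ bound = ^-cancelˡ-≤ (n * n) {{ℕ.m*n≢0 n n}} (begin
  ((ℓ ^ (3 * n)) ^ B) ^ (n * n)  ≡⟨ cong (_^ (n * n)) (ℕ.^-*-assoc ℓ (3 * n) B) ⟩
  (ℓ ^ (3 * n * B)) ^ (n * n)    ≡⟨ ℕ.^-*-assoc ℓ (3 * n * B) (n * n) ⟩
  ℓ ^ (3 * n * B * (n * n))      ≤⟨ bound ⟩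
  D * (2 * P) ^ (n * n)          ≤⟨ ℕ.*-monoˡ-≤ _ (n≤n^m D (n * n) {{ℕ.m*n≢0 n n}}) ⟩
  D ^ (n * n) * (2 * P) ^ (n * n) ≡⟨ ^-distribʳ-* D (2 * P) (n * n) ⟨
  (D * (2 * P)) ^ (n * n)        ≡⟨ cong (_^ (n * n)) (sym (ℕ.*-assoc D 2 P)) ⟩
  (D * 2 * P) ^ (n * n)          ∎)
  where
  open ℕ.≤-Reasoning
  D = divisorConstant (3 * n * B * (n * n))

countConstant : (n r : ℕ) → ℕ
countConstant n r = 3 ^ r * suc (n + (r + r)) ^ n + (n + 8) ^ n

-- As `P` and `ℓ` are at least `1`, each summand may take on the main factor of the other, and the
-- sum becomes a product that is easily raised to powers. The constants come from `2 P + 1 ≤ 3 P`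
-- and `n + 8 ℓ^3 ≤ (n + 8) ℓ^3`.
count-bound : ∀ n r ℓ → 1 ≤ P → 1 ≤ ℓ →
  decomposedBound n r P + coreBound n ℓ ≤ countConstant n r * ℓ ^ (3 * n) * P ^ r
count-bound {P} n r ℓ 1≤P 1≤ℓ = begin
  decomposedBound n r P + coreBound n ℓ
    ≤⟨ ℕ.+-mono-≤ decomposed core ⟩
  a * P ^ r * ℓ ^ (3 * n) + b * ℓ ^ (3 * n) * P ^ r
    ≡⟨ lemma a b (P ^ r) (ℓ ^ (3 * n)) ⟩
  (a + b) * ℓ ^ (3 * n) * P ^ r ∎
  where
  open ℕ.≤-Reasoning
  a = 3 ^ r * suc (n + (r + r)) ^ n
  b = (n + 8) ^ n
  lemma : ∀ a b p l → a * p * l + b * l * p ≡ (a + b) * l * p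
  lemma = ℕ.solve-∀
  decomposed : decomposedBound n r P ≤ a * P ^ r * ℓ ^ (3 * n)
  decomposed = begin
    suc (2 * P) ^ r * c      ≤⟨ ℕ.*-monoˡ-≤ c (ℕ.^-monoˡ-≤ r (ℕ.+-monoˡ-≤ (2 * P) 1≤P)) ⟩
    (3 * P) ^ r * c          ≡⟨ cong (_* c) (^-distribʳ-* 3 P r) ⟩
    3 ^ r * P ^ r * c        ≡⟨ lemma₁ (3 ^ r) (P ^ r) c ⟩
    a * P ^ r                ≤⟨ ℕ.m≤m*n _ (ℓ ^ (3 * n)) {{ℕ.m^n≢0 ℓ (3 * n) {{>-nonZero 1≤ℓ}}}} ⟩
    a * P ^ r * ℓ ^ (3 * n)  ∎
    where
    c = suc (n + (r + r)) ^ n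
    lemma₁ : ∀ t p c → t * p * c ≡ t * c * p
    lemma₁ = ℕ.solve-∀
  core : coreBound n ℓ ≤ b * ℓ ^ (3 * n) * P ^ r
  core = begin
    (n + 2 * ℓ * (2 * ℓ * (2 * ℓ))) ^ n  ≤⟨ ℕ.^-monoˡ-≤ n (ℕ.+-mono-≤ (ℕ.m≤m*n n (ℓ ^ 3) {{ℕ.m^n≢0 ℓ 3 {{>-nonZero 1≤ℓ}}}})
          (ℕ.≤-reflexive (lemma₁ ℓ))) ⟩
    (n * ℓ ^ 3 + 8 * ℓ ^ 3) ^ n          ≡⟨ cong (_^ n) (ℕ.*-distribʳ-+ (ℓ ^ 3) n 8) ⟨
    ((n + 8) * ℓ ^ 3) ^ n                ≡⟨ ^-distribʳ-* (n + 8) (ℓ ^ 3) n ⟩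
    b * (ℓ ^ 3) ^ n                      ≡⟨ cong (b *_) (ℕ.^-*-assoc ℓ 3 n) ⟩
    b * ℓ ^ (3 * n)                      ≤⟨ ℕ.m≤m*n _ (P ^ r) {{ℕ.m^n≢0 P r {{>-nonZero 1≤P}}}} ⟩
    b * ℓ ^ (3 * n) * P ^ r              ∎
    where
    lemma₁ : ∀ l → 2 * l * (2 * l * (2 * l)) ≡ 8 * (l * (l * (l * 1)))
    lemma₁ = ℕ.solve-∀

exponent≢0 : ∀ n B .{{_ : NonZero n}} .{{_ : NonZero B}} → NonZero (3 * n * B * (n * n))
exponent≢0 n B = ℕ.m*n≢0 (3 * n * B) (n * n) {{ℕ.m*n≢0 (3 * n) B {{ℕ.m*n≢0 3 n}}}} {{ℕ.m*n≢0 n n}}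

-- The constant left in the `B`-th power of the counting bound, to be absorbed by one factor `P`.
threshold : (n r B : ℕ) → ℕ
threshold n r B = countConstant n r ^ B * rootDivisorConstant n B

power-bound : ∀ n r B ℓ .{{_ : NonZero n}} → 1 ≤ P → 1 ≤ ℓ →
  ℓ ^ (3 * n * B * (n * n)) ≤ divisorConstant (3 * n * B * (n * n)) * (2 * P) ^ (n * n) →
  threshold n r B ≤ P → ∀ N → N ≤ decomposedBound n r P + coreBound n ℓ → N ^ B ≤ P ^ (2 + r * B)
power-bound {P} n r B ℓ 1≤P 1≤ℓ ℓ-bound large N N-bound = begin
  N ^ B                                          ≤⟨ ℕ.^-monoˡ-≤ B (ℕ.≤-trans N-bound (count-bound n r ℓ 1≤P 1≤ℓ)) ⟩
  (c * ℓ ^ (3 * n) * P ^ r) ^ B                  ≡⟨ ^-distribʳ-* (c * ℓ ^ (3 * n)) (P ^ r) B ⟩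
  (c * ℓ ^ (3 * n)) ^ B * (P ^ r) ^ B            ≡⟨ cong₂ _*_ (^-distribʳ-* c (ℓ ^ (3 * n)) B) (ℕ.^-*-assoc P r B) ⟩
  c ^ B * (ℓ ^ (3 * n)) ^ B * P ^ (r * B)        ≤⟨ ℕ.*-monoˡ-≤ (P ^ (r * B))
      (ℕ.*-monoʳ-≤ (c ^ B) (divisor-count-root n B ℓ ℓ-bound)) ⟩
  c ^ B * (d * P) * P ^ (r * B)                  ≡⟨ cong (_* P ^ (r * B)) (sym (ℕ.*-assoc (c ^ B) d P)) ⟩
  threshold n r B * P * P ^ (r * B)              ≤⟨ ℕ.*-monoˡ-≤ (P ^ (r * B)) (ℕ.*-monoˡ-≤ P large) ⟩
  P * P * P ^ (r * B)                            ≡⟨ ℕ.*-assoc P P _ ⟩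
  P ^ (2 + r * B)                                ∎
  where
  open ℕ.≤-Reasoning
  c = countConstant n r
  d = rootDivisorConstant n B

-- U ≪ P^(r + 1/B), and the implied constant is absorbed by another P^(1/B).
representation-or-power-bound : 2 ≤ k → ∀ (h : Vec ℤ k) r B .{{_ : NonZero B}} → let n = suc k in
  1 ≤ P → threshold n r B ≤ P →
  Representation P h (suc r) n ⊎ U n k P h ^ B ≤ P ^ (2 + r * B)
representation-or-power-bound {k} {P} 2≤k h r B 1≤P large
  with representation-or-bound 2≤k h r (3 * suc k * B * (suc k * suc k)) {{exponent≢0 (suc k) B}} 1≤P
... | inj₁ rep = inj₁ rep
... | inj₂ (ℓ , 1≤ℓ , ℓ-bound , U-bound) =
  inj₂ (power-bound (suc k) r B ℓ 1≤P 1≤ℓ ℓ-bound large (U (suc k) k P h) U-bound)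

-- Rational and real exponents

-- This is q ≥ 1 / d, where d is the denominator of q₀.
denominator-bound : ∀ q₀ q → 0ℚ ℚ.< q₀ → q₀ ℚ.< q → ↧ₙ q ≤ ∣ ↥ q ∣ * ↧ₙ q₀
denominator-bound (mkℚ (+ zero) _ _)  q (ℚ.*<* (ℤ.+<+ ())) q₀<q
denominator-bound (mkℚ (+ suc a) d _) (mkℚ (+ b) e _) 0<q₀ (ℚ.*<* q₀<q) =
  ℕ.≤-trans (ℕ.m≤n*m (suc e) (suc a))
    (ℕ.<⇒≤ (ℤ.drop‿+<+ (subst₂ ℤ._<_ (sym (ℤ.pos-* (suc a) (suc e))) (sym (ℤ.pos-* b (suc d))) q₀<q)))
denominator-bound (mkℚ (+ suc a) d _) (mkℚ -[1+ b ] e _) 0<q₀ (ℚ.*<* ())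
denominator-bound (mkℚ -[1+ a ] d _)  q (ℚ.*<* ()) q₀<q

lower<upper : ∀ (x : ℝ) {p q} → lower x p → upper x q → p ℚ.< q
lower<upper x {p} {q} lp uq with ℚ.<-cmp p q
... | tri< p<q _ _  = p<q
... | tri≈ _ refl _ = contradiction (lp , uq) (disjoint x)
... | tri> _ _ q<p  = contradiction (Equivalence.from (lower-rounded x) (p , q<p , lp) , uq) (disjoint x)

fromℚ : ℚ → ℝ
fromℚ c = record
  { lower           = ℚ._< c
  ; upper           = c ℚ.<_
  ; lower-inhabited = c ℚ.+ ℚ.- 1ℚ ,
      subst (c ℚ.+ ℚ.- 1ℚ ℚ.<_) (ℚ.+-identityʳ c)
        (ℚ.+-monoʳ-< c (from-yes (ℚ.- 1ℚ ℚ.<? 0ℚ)))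
  ; upper-inhabited = c ℚ.+ 1ℚ , subst (ℚ._< c ℚ.+ 1ℚ) (ℚ.+-identityʳ c) (ℚ.+-monoʳ-< c (from-yes (0ℚ ℚ.<? 1ℚ)))
  ; lower-rounded   = mk⇔ (λ p<c → let q , p<q , q<c = ℚ.<-dense p<c in q , p<q , q<c)
                          (λ (q , p<q , q<c) → ℚ.<-trans p<q q<c)
  ; upper-rounded   = mk⇔ (λ c<q → let p , c<p , p<q = ℚ.<-dense c<q in p , p<q , c<p)
                          (λ (p , p<q , c<p) → ℚ.<-trans c<p p<q)
  ; disjoint        = λ (q<c , c<q) → ℚ.<-asym q<c c<q
  ; located         = located′
  }
  where
  located′ : ∀ {p q} → p ℚ.< q → p ℚ.< c ⊎ c ℚ.< q
  located′ {p} p<q with p ℚ.<? c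
  ... | yes p<c = inj₁ p<c
  ... | no  p≮c = inj₂ (ℚ.≤-<-trans (ℚ.≮⇒≥ p≮c) p<q)

-- With `d` the denominator of `q₀`, the assumption reads `N ≤ P^(r + 1/d)`. Every rational `q`
-- above `η` exceeds `q₀ ≥ 1/d`, so `N` cannot exceed `P^(r + q)`.
power-bound⇒¬lowerBound : ∀ {r N P} q₀ η → 0ℚ ℚ.< q₀ → lower η q₀ → 1 ≤ P →
  N ^ (2 * ↧ₙ q₀) ≤ P ^ (2 + r * (2 * ↧ₙ q₀)) → ¬ (P ^[ r ⊕ η ]< N)
power-bound⇒¬lowerBound {r} {N} {P} q₀ η 0<q₀ lq₀ 1≤P bound (q , uq , large) =
  ℕ.<-irrefl refl (begin-strict
    (P ^ (r * b + a)) ^ B   <⟨ ℕ.^-monoˡ-< B large ⟩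
    (N ^ b) ^ B             ≡⟨ trans (ℕ.^-*-assoc N b B)
      (trans (cong (N ^_) (ℕ.*-comm b B)) (sym (ℕ.^-*-assoc N B b))) ⟩
    (N ^ B) ^ b             ≤⟨ ℕ.^-monoˡ-≤ b bound ⟩
    (P ^ (2 + r * B)) ^ b   ≡⟨ ℕ.^-*-assoc P (2 + r * B) b ⟩
    P ^ ((2 + r * B) * b)   ≤⟨ ℕ.^-monoʳ-≤ P {{>-nonZero 1≤P}} exponent ⟩
    P ^ ((r * b + a) * B)   ≡⟨ ℕ.^-*-assoc P (r * b + a) B ⟨
    (P ^ (r * b + a)) ^ B   ∎)
  where
  open ℕ.≤-Reasoning
  a = ∣ ↥ q ∣
  b = ↧ₙ q
  B = 2 * ↧ₙ q₀
  exponent : (2 + r * B) * b ≤ (r * b + a) * B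
  exponent = begin
    (2 + r * B) * b                  ≡⟨ lemma₁ r B b ⟩
    r * b * B + 2 * b                ≤⟨ ℕ.+-monoʳ-≤ (r * b * B)
      (ℕ.*-monoʳ-≤ 2 (denominator-bound q₀ q 0<q₀ (lower<upper η lq₀ uq))) ⟩
    r * b * B + 2 * (a * ↧ₙ q₀)      ≡⟨ lemma₂ r b a (↧ₙ q₀) ⟩
    (r * b + a) * B                  ∎
    where
    lemma₁ : ∀ r B b → (2 + r * B) * b ≡ r * b * B + 2 * b
    lemma₁ = ℕ.solve-∀
    lemma₂ : ∀ r b a d → r * b * (2 * d) + 2 * (a * d) ≡ (r * b + a) * (2 * d)
    lemma₂ = ℕ.solve-∀

-- The lower bound

bounded-++ : ∀ (x : Vec ℤ m) (y : Vec ℤ n) → Bounded P x → Bounded P y → Bounded P (x ++ y)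
bounded-++ []      y bx by i       = by i
bounded-++ (a ∷ x) y bx by zero    = bx zero
bounded-++ (a ∷ x) y bx by (suc i) = bounded-++ x y (bx ∘ suc) by i

add-pairs : ∀ {h : Vec ℤ k} (v : Vec ℤ m) (y : Vec ℤ n) → Bounded P v → Solution P h y →
            Solution P h (v ++ (Vec.map ℤ.-_ v ++ y))
add-pairs {P = P} v y bv sol = solves
  (bounded-++ v _ bv (bounded-++ (Vec.map ℤ.-_ v) y negated (bounded sol))) λ j →
  trans (trans (powerSum-++ (e j) v _) (cong (λ w → powerSum (e j) v ℤ.+ w) (trans
    (powerSum-++ (e j) (Vec.map ℤ.-_ v) y) (cong (λ w → w ℤ.+ powerSum (e j) y) (odd-powerSum-neg (toℕ j) v)))))
  (trans (lemma (powerSum (e j) v) (powerSum (e j) y)) (system sol j))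
  where
  e : Fin _ → ℕ
  e j = suc (2 * toℕ j)
  lemma : ∀ a b → a ℤ.+ (ℤ.- a ℤ.+ b) ≡ b
  lemma = ℤ.solve-∀
  negated : Bounded P (Vec.map ℤ.-_ v)
  negated i rewrite Vec.lookup-map i ℤ.-_ v | ℤ.∣-i∣≡∣i∣ (lookup v i) = bv i

-- The `f` pair values can be chosen freely, and distinct choices give distinct solutions because
-- the choice is the initial block.
power≤U : ∀ (h : Vec ℤ k) f (y : Vec ℤ m) → Solution P h y → n ≡ f + (f + m) → P ^ f ≤ U n k P h
power≤U {k} {m} {P} h f y sol refl = begin
  P ^ f                          ≤⟨ ℕ.^-monoˡ-≤ f (ℕ.≤-trans (ℕ.m≤m+n P _) (ℕ.n≤1+n _)) ⟩
  suc (2 * P) ^ f                ≡⟨ cong (_^ f) (length-interval P) ⟨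
  length (interval P) ^ f        ≡⟨ length-tuples (interval P) f ⟨
  length (tuples (interval P) f) ≡⟨ List.length-map φ (tuples (interval P) f) ⟨
  length (List.map φ (tuples (interval P) f)) ≤⟨ ≤U h (Unique.map⁺ (Vec.++-injectiveˡ _ _) (tuples-unique (interval-unique P) f))
       φ-solution ⟩
  U (f + (f + m)) k P h          ∎
  where
  open ℕ.≤-Reasoning
  φ : Vec ℤ f → Vec ℤ (f + (f + m))
  φ v = v ++ (Vec.map ℤ.-_ v ++ y)
  φ-solution : ∀ {x} → x ∈ List.map φ (tuples (interval P) f) → Solution P h x
  φ-solution x∈ with v , v∈ , refl ← ∈-map⁻ φ x∈ = add-pairs v y (∈-interval⁻ ∘ ∈-tuples⁻ v∈) sol

U-trivial : ∀ n k P (h : Vec ℤ k) → U n k P h ≤ suc (2 * P) ^ n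
U-trivial n k P h = ℕ.≤-trans (List.length-filter (oddPowerSystem? h) (tuples (interval P) n))
  (ℕ.≤-reflexive (trans (length-tuples (interval P) n) (cong (_^ n) (length-interval P))))

-- Representations, thresholds and implied constants

bounded⇒all : ∀ (x : Vec ℤ n) → Bounded P x → All (λ a → ∣ a ∣ ≤ P) x
bounded⇒all []      b = []
bounded⇒all (a ∷ x) b = b zero ∷ bounded⇒all x (b ∘ suc)

all⇒bounded : ∀ {x : Vec ℤ n} → All (λ a → ∣ a ∣ ≤ P) x → Bounded P x
all⇒bounded (a ∷ as) zero    = a
all⇒bounded (a ∷ as) (suc i) = all⇒bounded as i

-- Comparing lengths, `k + 1 = 2 (r + 1) + m` yields both the bound on `r` and the number `m` of
-- remaining entries.
representation⇒conclusion : 1 ≤ k → ∀ {h : Vec ℤ k} r → Representation P h (suc r) (suc k) →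
  2 * r ≤ k ∸ 1 × (Σ[ a ∈ Vec ℤ (k ∸ 1 ∸ 2 * r) ] All (λ aᵢ → ∣ aᵢ ∣ ≤ P) a × OddPowerSystem h a)
representation⇒conclusion {suc k} {P} 1≤k {h} r (m , eq , y , sol) =
  subst (2 * r ≤_) (sym k≡) (ℕ.m≤m+n (2 * r) m) ,
  subst (λ m → Σ[ a ∈ Vec ℤ m ] All (λ aᵢ → ∣ aᵢ ∣ ≤ P) a × OddPowerSystem h a)
    (sym (trans (cong (_∸ 2 * r) k≡) (ℕ.m+n∸m≡n (2 * r) m)))
    (y , bounded⇒all y (bounded sol) , system sol)
  where
  k≡ : k ≡ 2 * r + m
  k≡ = ℕ.suc-injective (ℕ.suc-injective (trans eq (cong (_+ m) (ℕ.*-suc 2 r))))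

conclusion-length : ∀ k r → 1 ≤ k → 2 * r ≤ k ∸ 1 → suc k ≡ suc r + (suc r + (k ∸ 1 ∸ 2 * r))
conclusion-length (suc k) r 1≤k 2r≤k =
  trans (cong (λ z → 2 + z) (sym (ℕ.m+[n∸m]≡n 2r≤k))) (lemma r (k ∸ 2 * r))
  where
  lemma : ∀ r m → 2 + (2 * r + m) ≡ suc r + (suc r + m)
  lemma = ℕ.solve-∀

-- A sum in place of a maximum: it only has to dominate each value.
upperBoundOn : (ℕ → ℕ) → ℕ → ℕ
upperBoundOn f zero    = f 0
upperBoundOn f (suc n) = f (suc n) + upperBoundOn f n

≤upperBoundOn : ∀ f {i} n → i ≤ n → f i ≤ upperBoundOn f n
≤upperBoundOn f zero    z≤n = ℕ.≤-refl
≤upperBoundOn f (suc n) i≤1+n with ℕ.m≤n⇒m<n∨m≡n i≤1+n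
... | inj₁ i<1+n = ℕ.≤-trans (≤upperBoundOn f n (ℕ.≤-pred i<1+n)) (ℕ.m≤n+m _ _)
... | inj₂ refl  = ℕ.m≤m+n _ _

rationalBelow : (x : ℝ) → Positive x → Σ[ q ∈ ℚ ] 0ℚ ℚ.< q × lower x q
rationalBelow x = Equivalence.to (lower-rounded x)

-- Isolated as a property, so that the asymptotic part applies to any threshold that has it.
Represents : Threshold → ℕ → Set₁
Represents P₀ k = ∀ (η : ℝ) (η∈I : InUnitInterval η) (r P : ℕ) →
  1 ≤ P → P₀ η η∈I r ≤ P →
  ∀ (h : Vec ℤ k) → LowerBound k P h r η →
  2 * r ≤ k ∸ 1
  × (Σ[ a ∈ Vec ℤ (k ∸ 1 ∸ 2 * r) ]
       All (λ aᵢ → ∣ aᵢ ∣ ≤ P) a × OddPowerSystem h a)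

-- The power `B` is twice the denominator of a rational between `0` and `η`, as
-- `power-bound⇒¬lowerBound` requires.
explicitThreshold : ℕ → Threshold
explicitThreshold k η (0<η , _) r = threshold (suc k) r (2 * ↧ₙ (proj₁ (rationalBelow η 0<η)))

explicitThreshold-represents : 2 ≤ k → Represents (explicitThreshold k) k
explicitThreshold-represents {k} 2≤k η (0<η , η<1) r P 1≤P large h lowerBound =
  [ representation⇒conclusion (ℕ.≤-trans (s≤s z≤n) 2≤k) r
  , (λ bound → contradiction lowerBound
      (power-bound⇒¬lowerBound {r} {U (suc k) k P h} {P} q₀ η (proj₁ (proj₂ below))
        (proj₂ (proj₂ below)) 1≤P bound))
  ]′ (representation-or-power-bound 2≤k h r (2 * ↧ₙ q₀) 1≤P large)
  where
  below = rationalBelow η 0<η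
  q₀ = proj₁ below

-- A real in (0,1) that does not exceed a given positive rational.
unit⊓ : ℚ → ℝ
unit⊓ q = fromℚ (q ℚ.⊓ ½)

unit⊓-inUnitInterval : ∀ q → 0ℚ ℚ.< q → InUnitInterval (unit⊓ q)
unit⊓-inUnitInterval q 0<q =
  [ (λ e → subst (0ℚ ℚ.<_) (sym e) 0<q) ,
    (λ e → subst (0ℚ ℚ.<_) (sym e) (from-yes (0ℚ ℚ.<? ½))) ]′ (ℚ.⊓-sel q ½) ,
  ℚ.≤-<-trans (ℚ.p⊓q≤q q ½) (from-yes (½ ℚ.<? 1ℚ))

upper-unit⊓ : ∀ ε {q₀ q} → lower ε q₀ → upper ε q → upper (unit⊓ q₀) q
upper-unit⊓ ε {q₀} q₀<ε ε<q = ℚ.≤-<-trans (ℚ.p⊓q≤p q₀ ½) (lower<upper ε q₀<ε ε<q)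

-- The representation has `k - 1 - 2 r` entries, which leaves room for `r + 1` free pairs among
-- `k + 1` entries.
largest-lower : ∀ {P₀} → 2 ≤ k → Represents P₀ k → ∀ {h : Vec ℤ k} {r} → 1 ≤ P →
  LowerBoundForSome P₀ k P h r → 2 * r ≤ k ∸ 1 × P ^ suc r ≤ U (suc k) k P h
largest-lower {k} {P} 2≤k represents {h} {r} 1≤P (η , η∈I , large , lowerBound) =
  let 2r≤k-1 , y , y-bounded , y-system = represents η η∈I r P 1≤P large h lowerBound in
  2r≤k-1 , power≤U h (suc r) y (solves (all⇒bounded y-bounded) y-system)
    (conclusion-length k r (ℕ.≤-trans (s≤s z≤n) 2≤k) 2r≤k-1)

-- Since r is largest, the lower bound fails at r + 1 for an exponent
-- below ε, unless P is too small for this exponent.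
largest-upper : ∀ {P₀} ε η η∈I → (∀ {q} → upper ε q → upper η q) → ∀ {C P N k h r} → N ≡ U (suc k) k P h →
  1 ≤ P → 1 ≤ C → (P ≤ P₀ η η∈I (suc r) → N ≤ C) →
  IsLargest (LowerBoundForSome P₀ k P h) r → N ≤ C · P ^[ suc r ⊕ ε ]
largest-upper {P₀} ε η η∈I ε⇒η {C} {P} {N} {r = r} refl 1≤P 1≤C small (_ , largest) q ε<q =
  [ (λ P₀≤P → ℕ.≤-trans
      (ℕ.≮⇒≥ λ lt → ℕ.<-irrefl refl (largest (suc r) (η , η∈I , P₀≤P , q , ε⇒η ε<q , lt)))
      (ℕ.m≤n*m _ (C ^ ↧ₙ q) {{ℕ.m^n≢0 C (↧ₙ q) {{>-nonZero 1≤C}}}}))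
  , (λ P≤P₀ → ℕ.≤-trans (ℕ.^-monoˡ-≤ (↧ₙ q) (small P≤P₀))
      (ℕ.m≤m*n (C ^ ↧ₙ q) _ {{ℕ.m^n≢0 P (suc r * ↧ₙ q + ∣ ↥ q ∣) {{>-nonZero 1≤P}}}}))
  ]′ (ℕ.≤-total (P₀ η η∈I (suc r)) P)

asymptotics : ∀ (P₀ : Threshold) → 2 ≤ k → Represents P₀ k → ∀ (ε : ℝ) → Positive ε →
  Σ[ C ∈ ℕ ] (∀ (P : ℕ) → 1 ≤ P → ∀ (h : Vec ℤ k) (r : ℕ) → IsLargest (LowerBoundForSome P₀ k P h) r →
    P ^ suc r ≤ C * U (suc k) k P h × (U (suc k) k P h ≤ C · P ^[ suc r ⊕ ε ]))
asymptotics {k} P₀ 2≤k represents ε 0<ε = C , bounds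
  where
  below = rationalBelow ε 0<ε
  q₀ = proj₁ below
  η = unit⊓ q₀
  η∈I = unit⊓-inUnitInterval q₀ (proj₁ (proj₂ below))
  -- Since `r ≤ k`, finitely many thresholds occur, and `P₁` bounds them all.
  P₁ = upperBoundOn (λ r → P₀ η η∈I (suc r)) k
  -- This is the number of all tuples for `P₁`, so it bounds the count whenever `P ≤ P₁`.
  C = suc (2 * P₁) ^ suc k
  1≤C : 1 ≤ C
  1≤C = ℕ.m^n>0 (suc (2 * P₁)) (suc k)
  bounds : ∀ (P : ℕ) → 1 ≤ P → ∀ (h : Vec ℤ k) (r : ℕ) → IsLargest (LowerBoundForSome P₀ k P h) r →
    P ^ suc r ≤ C * U (suc k) k P h × (U (suc k) k P h ≤ C · P ^[ suc r ⊕ ε ])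
  bounds P 1≤P h r isLargest@(lowerBound , _) =
    ℕ.≤-trans (proj₂ lower-bound) (ℕ.m≤n*m (U (suc k) k P h) C {{>-nonZero 1≤C}}) ,
    largest-upper {P₀} ε η η∈I (upper-unit⊓ ε (proj₂ (proj₂ below))) {h = h} refl 1≤P 1≤C small isLargest
    where
    lower-bound = largest-lower 2≤k represents {h} {r} 1≤P lowerBound
    r≤k : r ≤ k
    r≤k = ℕ.≤-trans (ℕ.m≤m+n r (r + 0)) (ℕ.≤-trans (proj₁ lower-bound) (ℕ.m∸n≤m k 1))
    small : P ≤ P₀ η η∈I (suc r) → U (suc k) k P h ≤ C
    small P≤P₀ = ℕ.≤-trans (U-trivial (suc k) k P h) (ℕ.^-monoˡ-≤ (suc k) (s≤s (ℕ.*-monoʳ-≤ 2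
      (ℕ.≤-trans P≤P₀ (≤upperBoundOn (λ r → P₀ η η∈I (suc r)) k r≤k)))))

theorem1p5 : ∀ (k : ℕ) → 2 ≤ k →
    Σ[ P₀ ∈ Threshold ]
    ( (∀ (η : ℝ) (η∈I : InUnitInterval η) (r P : ℕ) →
    1 ≤ P → P₀ η η∈I r ≤ P →
    ∀ (h : Vec ℤ k) → LowerBound k P h r η →
    2 * r ≤ k ∸ 1
    × (Σ[ a ∈ Vec ℤ (k ∸ 1 ∸ 2 * r) ]
    All (λ aᵢ → ∣ aᵢ ∣ ≤ P) a × OddPowerSystem h a))
    × (∀ (ε : ℝ) → Positive ε →
    Σ[ C ∈ ℕ ]
    (∀ (P : ℕ) → 1 ≤ P → ∀ (h : Vec ℤ k) (r : ℕ) →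
    IsLargest (LowerBoundForSome P₀ k P h) r →
    P ^ suc r ≤ C * U (suc k) k P h
    × (U (suc k) k P h ≤ C · P ^[ suc r ⊕ ε ]))) )
theorem1p5 k 2≤k = explicitThreshold k , explicitThreshold-represents 2≤k ,
  asymptotics (explicitThreshold k) 2≤k (explicitThreshold-represents 2≤k)
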